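{- Every even integer $n > 3$ can be written as $n = p + \eta$, where $p$ is a prime and $\eta$ is an odd square-free number.
   Context: A square-free number is a positive integer not divisible by the square of any prime; in particular $1$ is square-free. -}

module Defs where

open import Data.Nat using (ℕ; _*_; _<_)
open import Data.Nat.Divisibility using (_∤_)
open import Data.Nat.Primality using (Prime)
open import Data.Product using (_×_)

SquareFree : ℕ → Set
SquareFree n = 0 < n × (∀ p → Prime p → p * p ∤ n)

module Submission where

-- Suppose n is large and every odd prime p < n has an odd prime q with q² ∣ n − p.  For fixed q
-- these p lie in one progression modulo d = 2q², whose terms below n number M ≈ n / d.  The product
-- of the M terms is divisible by the part E of M! prime to d; the quotient Q is at most (8q²)^M and
-- is divisible by each such p > M.  Multiplying the Q over all q, by a number ≤ 4^(n/18) divisible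
-- by all primes ≤ n/18 (as M ≤ n/18 for q ≥ 3), and by the square of a common multiple of the
-- integers up to √n, one gets a common multiple of 1, …, n − 1.  Any such multiple is at least
-- 2^(n−2), because beta a b = 1 / ∫ x^a (1−x)^b dx divides it for all a + b < n − 1.  But the number
-- constructed is at most 2^(0.97 n), essentially because Σ_q log₂(8q²) / 2q² + 1/9 < 1, where q runs
-- over the odd primes.  The contradiction is reached for n ≥ 65536, and smaller n are checked by
-- evaluation with a prime p ≤ 29.

-- The primes of one progression must be weighed by log p without a factor log n: bounding each of
-- the M terms by n would give Σ (n / 2q²) log n, far too much for large n. Dividing by E removes
-- this factor, since the product is at most d^M · M! and E ≥ M! / 4^M; what remains, log₂ (8q²) per
-- term, is summable against 1 / 2q², so q may run up to √n. The constants are tight. The parity of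
-- n - p, which fixes the class of p modulo 2q² and not only modulo q², is essential: the same
-- argument modulo q² leads to Σ log₂ (2q²) / q², which exceeds 1 once q reaches 23. For the same
-- reason the primes q < 512 are estimated one by one, while the larger odd q, prime or not, are
-- estimated in dyadic blocks. The square of a common multiple up to √n supplies the prime powers
-- p^e with e ≥ 2 and costs only O(√n) in the exponent.

open import Defs
open import Data.Bool using (Bool; true; _∧_; not; T)
open import Data.Bool.ListAction using (all; any)
open import Data.Bool.Properties using (T-∧)
open import Data.List using (List; []; _∷_)
open import Data.List.Relation.Unary.All as All using (All; []; _∷_; all?)
open import Data.List.Relation.Unary.All.Properties using (all⁺)
open import Data.List.Relation.Unary.Any as Any using (Any; here; there; any?)
open import Data.List.Relation.Unary.Any.Properties using (any⁻)
open import Data.Nat using (ℕ; zero; suc; _+_; _*_; _∸_; _^_; _!; _≤_; _<_; _>_; z≤n; s≤s; NonZero; ≢-nonZero⁻¹; >-nonZero; nonTrivial⇒n>1; n>1⇒nonTrivial; _<ᵇ_; _≡ᵇ_)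
open import Data.Nat.Combinatorics using (_C_; nCk≡n!/k![n-k]!; k![n∸k]!∣n!)
open import Data.Nat.Coprimality using (Coprime; coprime-divisor; coprime-Bézout) renaming (sym to coprime-sym)
open import Data.Nat.DivMod using (_/_; _%_; m≡m%n+[m/n]*n; m%n<n; m/n<m; m/n*n≡m; m/n*n≤m; m*n/n≡m; /-monoˡ-≤)
open import Data.Nat.Divisibility
open import Data.Nat.GCD using (module Bézout)
open import Data.Nat.Induction using (<-rec)
open import Data.Nat.Primality
open import Data.Nat.Properties
open import Data.Nat.Tactic.RingSolver using (solve-∀)
open import Data.Product using (_×_; _,_; ∃; ∃₂; proj₁; proj₂)
open import Data.Sum as Sum using (_⊎_; inj₁; inj₂; [_,_]′)
open import Function using (Equivalence)
open import Relation.Binary.PropositionalEquality using (_≡_; refl; sym; trans; cong; cong₂; subst; module ≡-Reasoning)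
open import Relation.Nullary using (Dec; yes; no; contradiction; ¬_)
open import Relation.Nullary.Decidable using (toWitness; _×-dec_; _⊎-dec_; ¬?; decidable-stable)

-- Binomial coefficients and primorials

binom-! : ∀ a b → ((a + b) C a) * (a ! * b !) ≡ (a + b) !
binom-! a b = begin
  ((a + b) C a) * (a ! * b !)               ≡⟨ cong (λ x → ((a + b) C a) * (a ! * x !)) (sym (m+n∸m≡n a b)) ⟩
  ((a + b) C a) * (a ! * (a + b ∸ a) !)     ≡⟨ cong (_* (a ! * (a + b ∸ a) !)) (nCk≡n!/k![n-k]! (m≤m+n a b)) ⟩
  _                                         ≡⟨ m/n*n≡m (k![n∸k]!∣n! (m≤m+n a b)) ⟩
  (a + b) !                                 ∎
  where
  open ≡-Reasoning
  instance _ = a !* (a + b ∸ a) !≢0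

n!>0 : ∀ n → 0 < n !
n!>0 n = n≢0⇒n>0 (≢-nonZero⁻¹ (n !) {{n !≢0}})

prime∣n!⇒p≤n : ∀ {p} → Prime p → ∀ n → p ∣ n ! → p ≤ n
prime∣n!⇒p≤n pp zero p∣1 = contradiction (subst Prime (∣1⇒≡1 p∣1) pp) ¬prime[1]
prime∣n!⇒p≤n pp (suc n) p∣ with euclidsLemma (suc n) (n !) pp p∣
... | inj₁ p∣1+n = ∣⇒≤ p∣1+n
... | inj₂ p∣n! = m≤n⇒m≤1+n (prime∣n!⇒p≤n pp n p∣n!)

m∣n! : ∀ {m n} → 0 < m → m ≤ n → m ∣ n !
m∣n! {suc m} _ m≤n = ∣-trans (m∣m*n (m !)) (m≤n⇒m!∣n! m≤n)

prime>0 : ∀ {p} → Prime p → 0 < p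
prime>0 {zero} pp = contradiction pp ¬prime[0]
prime>0 {suc _} _ = s≤s z≤n

prime∣binom : ∀ {p} a b → Prime p → a < p → b < p → p ≤ a + b → p ∣ (a + b) C a
prime∣binom {p} a b pp a<p b<p p≤a+b
  with euclidsLemma ((a + b) C a) (a ! * b !) pp (subst (p ∣_) (sym (binom-! a b)) (m∣n! (prime>0 pp) p≤a+b))
... | inj₁ p∣C = p∣C
... | inj₂ p∣! with euclidsLemma (a !) (b !) pp p∣!
...   | inj₁ p∣a! = contradiction (prime∣n!⇒p≤n pp a p∣a!) (<⇒≱ a<p)
...   | inj₂ p∣b! = contradiction (prime∣n!⇒p≤n pp b p∣b!) (<⇒≱ b<p)

binom>0 : ∀ a b → 0 < (a + b) C a
binom>0 a b = n≢0⇒n>0 λ C≡0 → n>0⇒n≢0 (n!>0 (a + b)) (trans (sym (binom-! a b)) (cong (_* (a ! * b !)) C≡0))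

-- Consecutive values have the ratio (2k + 3)(2k + 2) / ((k + 1)(k + 2)), which is below 4; `slack`
-- is the difference after clearing denominators.
binom-odd≤ : ∀ k → (k + suc k) C k ≤ 4 ^ k
binom-odd≤ zero = ≤-refl
binom-odd≤ (suc k) = *-cancelʳ-≤ _ _ (suc k * (2 + k)) (begin
  ((suc k + (2 + k)) C suc k) * (suc k * (2 + k)) ≡⟨ *-cancelʳ-≡ _ _ _ {{k !* suc k !≢0}} rec ⟩
  ((k + suc k) C k) * ((3 + (k + k)) * (2 + (k + k))) ≤⟨ *-mono-≤ (binom-odd≤ k) grow ⟩
  4 ^ k * (4 * (suc k * (2 + k)))                ≡⟨ regroup (4 ^ k) (suc k * (2 + k)) ⟩
  4 ^ suc k * (suc k * (2 + k))                  ∎)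
  where
  open ≤-Reasoning
  regroup : ∀ x y → x * (4 * y) ≡ 4 * x * y
  regroup = solve-∀
  shape : ∀ k → suc k + (2 + k) ≡ 3 + (k + k)
  shape = solve-∀
  shape′ : ∀ k → suc (k + k) ≡ k + suc k
  shape′ = solve-∀
  grow : (3 + (k + k)) * (2 + (k + k)) ≤ 4 * (suc k * (2 + k))
  grow = subst ((3 + (k + k)) * (2 + (k + k)) ≤_) (slack k) (m≤m+n _ (2 * k + 2))
    where
    slack : ∀ k → (3 + (k + k)) * (2 + (k + k)) + (2 * k + 2) ≡ 4 * (suc k * (2 + k))
    slack = solve-∀
  split-! : ∀ c k x y → c * (suc k * (2 + k)) * (x * y) ≡ c * (suc k * x * ((2 + k) * y))
  split-! = solve-∀
  merge-! : ∀ u v c w → u * (v * (c * w)) ≡ c * (u * v) * w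
  merge-! = solve-∀
  rec : ((suc k + (2 + k)) C suc k) * (suc k * (2 + k)) * (k ! * suc k !)
        ≡ ((k + suc k) C k) * ((3 + (k + k)) * (2 + (k + k))) * (k ! * suc k !)
  rec = begin-equality
    ((suc k + (2 + k)) C suc k) * (suc k * (2 + k)) * (k ! * suc k !) ≡⟨ split-! ((suc k + (2 + k)) C suc k) k (k !) (suc k !) ⟩
    ((suc k + (2 + k)) C suc k) * (suc k ! * (2 + k) !) ≡⟨ binom-! (suc k) (2 + k) ⟩
    (suc k + (2 + k)) ! ≡⟨ cong _! (shape k) ⟩
    (3 + (k + k)) * ((2 + (k + k)) * (suc (k + k)) !) ≡⟨ cong (λ x → (3 + (k + k)) * ((2 + (k + k)) * x !)) (shape′ k) ⟩
    (3 + (k + k)) * ((2 + (k + k)) * (k + suc k) !) ≡⟨ cong (λ x → (3 + (k + k)) * ((2 + (k + k)) * x)) (sym (binom-! k (suc k))) ⟩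
    (3 + (k + k)) * ((2 + (k + k)) * (((k + suc k) C k) * (k ! * suc k !))) ≡⟨ merge-! (3 + (k + k)) (2 + (k + k)) ((k + suc k) C k) (k ! * suc k !) ⟩
    ((k + suc k) C k) * ((3 + (k + k)) * (2 + (k + k))) * (k ! * suc k !) ∎

-- By the odd case, as C(2k + 2, k + 1) = 2 C(2k + 1, k).
binom-even≤ : ∀ k → (k + k) C k ≤ 4 ^ k
binom-even≤ zero = ≤-refl
binom-even≤ (suc k) = begin
  (suc k + suc k) C suc k  ≡⟨ *-cancelʳ-≡ _ _ (suc k * (k ! * suc k !)) {{m*n≢0 (suc k) _ {{_}} {{k !* suc k !≢0}}}} rec ⟩
  2 * ((k + suc k) C k)    ≤⟨ *-mono-≤ {2} {4} (s≤s (s≤s z≤n)) (binom-odd≤ k) ⟩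
  4 ^ suc k                ∎
  where
  open ≤-Reasoning
  split-! : ∀ c k x y → c * (suc k * (x * y)) ≡ c * (suc k * x * y)
  split-! = solve-∀
  merge-! : ∀ k c w → (suc k + suc k) * (c * w) ≡ 2 * c * (suc k * w)
  merge-! = solve-∀
  rec : ((suc k + suc k) C suc k) * (suc k * (k ! * suc k !)) ≡ 2 * ((k + suc k) C k) * (suc k * (k ! * suc k !))
  rec = begin-equality
    ((suc k + suc k) C suc k) * (suc k * (k ! * suc k !)) ≡⟨ split-! ((suc k + suc k) C suc k) k (k !) (suc k !) ⟩
    ((suc k + suc k) C suc k) * (suc k ! * suc k !)  ≡⟨ binom-! (suc k) (suc k) ⟩
    (suc k + suc k) * (k + suc k) !                  ≡⟨ cong ((suc k + suc k) *_) (sym (binom-! k (suc k))) ⟩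
    (suc k + suc k) * (((k + suc k) C k) * (k ! * suc k !)) ≡⟨ merge-! k ((k + suc k) C k) (k ! * suc k !) ⟩
    2 * ((k + suc k) C k) * (suc k * (k ! * suc k !)) ∎

-- The odd case is written `k + suc k`, so that a match displays the number as a sum of two nearly
-- equal parts, ready for `(a + b) C a`.
data Half : ℕ → Set where
  double   : ∀ k → Half (k + k)
  double+1 : ∀ k → Half (k + suc k)

half : ∀ n → Half n
half zero = double 0
half (suc n) with half n
... | double k   = subst Half (+-suc k k) (double+1 k)
... | double+1 k = double (suc k)

PrimorialBound : ℕ → Set
PrimorialBound m = ∃ λ X → 0 < X × X ≤ 4 ^ m × (∀ p → Prime p → p ≤ m → p ∣ X)

-- Erdős' argument: split m = a + b with b = a or b = a + 1. The primes in (b, a + b] divide C(a +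
-- b, a) ≤ 4^a, and those up to b come from the recursive call, at the cost 4^b.
primorial-bound : ∀ m → PrimorialBound m
primorial-bound = <-rec PrimorialBound step
  where
  combine : ∀ a b → PrimorialBound b → a ≤ b → (a + b) C a ≤ 4 ^ a → PrimorialBound (a + b)
  combine a b (X , X>0 , X≤ , primes) a≤b C≤ =
    ((a + b) C a) * X , *-mono-≤ (binom>0 a b) X>0 ,
    subst (((a + b) C a) * X ≤_) (sym (^-distribˡ-+-* 4 a b)) (*-mono-≤ C≤ X≤) , divs
    where
    divs : ∀ p → Prime p → p ≤ a + b → p ∣ ((a + b) C a) * X
    divs p pp p≤ with p ≤? b
    ... | yes p≤b = ∣n⇒∣m*n ((a + b) C a) (primes p pp p≤b)
    ... | no p≰b = ∣m⇒∣m*n X (prime∣binom a b pp (≤-<-trans a≤b (≰⇒> p≰b)) (≰⇒> p≰b) p≤)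

  step : ∀ m → (∀ {k} → k < m → PrimorialBound k) → PrimorialBound m
  step m rec with half m
  ... | double zero = 1 , s≤s z≤n , s≤s z≤n , λ p pp p≤0 → contradiction (≤-trans (prime>0 pp) p≤0) λ ()
  ... | double (suc k) = combine (suc k) (suc k) (rec (m<m+n (suc k) (s≤s z≤n))) ≤-refl (binom-even≤ (suc k))
  ... | double+1 zero = 1 , s≤s z≤n , s≤s z≤n , λ p pp p≤1 → contradiction (subst Prime (≤-antisym p≤1 (prime>0 pp)) pp) ¬prime[1]
  ... | double+1 (suc k) = combine (suc k) (2 + k) (rec (m<n+m (2 + k) (s≤s z≤n))) (n≤1+n _) (binom-odd≤ (suc k))

-- Common multiples of consecutive integers

beta : ℕ → ℕ → ℕ
beta a b = suc (a + b) * ((a + b) C a)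

beta-! : ∀ a b → beta a b * (a ! * b !) ≡ suc (a + b) !
beta-! a b = trans (*-assoc (suc (a + b)) ((a + b) C a) _) (cong (suc (a + b) *_) (binom-! a b))

beta-sucˡ : ∀ a b → beta (suc a) b * suc a ≡ beta a b * (2 + (a + b))
beta-sucˡ a b = *-cancelʳ-≡ _ _ (a ! * b !) {{a !* b !≢0}} (begin
  beta (suc a) b * suc a * (a ! * b !) ≡⟨ regroup (beta (suc a) b) (suc a) (a !) (b !) ⟩
  beta (suc a) b * (suc a ! * b !)     ≡⟨ beta-! (suc a) b ⟩
  (2 + (a + b)) * suc (a + b) !        ≡⟨ cong ((2 + (a + b)) *_) (sym (beta-! a b)) ⟩
  (2 + (a + b)) * (beta a b * (a ! * b !)) ≡⟨ regroup′ (2 + (a + b)) (beta a b) (a ! * b !) ⟩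
  beta a b * (2 + (a + b)) * (a ! * b !) ∎)
  where
  open ≡-Reasoning
  regroup : ∀ c k x y → c * k * (x * y) ≡ c * (k * x * y)
  regroup = solve-∀
  regroup′ : ∀ u c w → u * (c * w) ≡ c * u * w
  regroup′ = solve-∀

beta-sym : ∀ a b → beta a b ≡ beta b a
beta-sym a b = *-cancelʳ-≡ _ _ (a ! * b !) {{a !* b !≢0}} (begin
  beta a b * (a ! * b !)  ≡⟨ beta-! a b ⟩
  suc (a + b) !           ≡⟨ cong (λ x → suc x !) (+-comm a b) ⟩
  suc (b + a) !           ≡⟨ sym (beta-! b a) ⟩
  beta b a * (b ! * a !)  ≡⟨ cong (beta b a *_) (*-comm (b !) (a !)) ⟩
  beta b a * (a ! * b !)  ∎)
  where open ≡-Reasoning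

beta-sucʳ : ∀ a b → beta a (suc b) * suc b ≡ beta a b * (2 + (a + b))
beta-sucʳ a b = begin
  beta a (suc b) * suc b       ≡⟨ cong (_* suc b) (beta-sym a (suc b)) ⟩
  beta (suc b) a * suc b       ≡⟨ beta-sucˡ b a ⟩
  beta b a * (2 + (b + a))     ≡⟨ cong₂ (λ x y → x * (2 + y)) (beta-sym b a) (+-comm b a) ⟩
  beta a b * (2 + (a + b))     ∎
  where open ≡-Reasoning

beta>0 : ∀ a b → 0 < beta a b
beta>0 a b = *-mono-≤ {1} {suc (a + b)} (s≤s z≤n) (binom>0 a b)

-- Each step multiplies `beta m m` by (2m + 2)(2m + 3) / (m + 1)² ≥ 4. The central binomial
-- coefficient alone would fall short by a polynomial factor.
4^m≤beta : ∀ m → 4 ^ m ≤ beta m m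
4^m≤beta zero = ≤-refl
4^m≤beta (suc m) = *-cancelʳ-≤ _ _ (suc m * suc m) (begin
  4 ^ suc m * (suc m * suc m)                     ≡⟨ regroup (4 ^ m) m ⟩
  4 ^ m * ((2 + (m + m)) * (2 + (m + m)))         ≤⟨ *-mono-≤ (4^m≤beta m) (*-monoʳ-≤ (2 + (m + m)) (n≤1+n (2 + (m + m)))) ⟩
  beta m m * ((2 + (m + m)) * (3 + (m + m)))      ≡⟨ regroup₂ (beta m m) m ⟩
  beta m m * (2 + (m + m)) * (2 + (m + suc m))    ≡⟨ cong (_* (2 + (m + suc m))) (sym (beta-sucʳ m m)) ⟩
  beta m (suc m) * suc m * (2 + (m + suc m))      ≡⟨ regroup₃ (beta m (suc m)) (suc m) (2 + (m + suc m)) ⟩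
  beta m (suc m) * (2 + (m + suc m)) * suc m      ≡⟨ cong (_* suc m) (sym (beta-sucˡ m (suc m))) ⟩
  beta (suc m) (suc m) * suc m * suc m            ≡⟨ *-assoc (beta (suc m) (suc m)) (suc m) (suc m) ⟩
  beta (suc m) (suc m) * (suc m * suc m)          ∎)
  where
  open ≤-Reasoning
  regroup : ∀ x m → 4 * x * (suc m * suc m) ≡ x * ((2 + (m + m)) * (2 + (m + m)))
  regroup = solve-∀
  regroup₂ : ∀ x m → x * ((2 + (m + m)) * (3 + (m + m))) ≡ x * (2 + (m + m)) * (2 + (m + suc m))
  regroup₂ = solve-∀
  regroup₃ : ∀ x y z → x * y * z ≡ x * z * y
  regroup₃ = solve-∀

CommonMultiple : ℕ → ℕ → Set
CommonMultiple n L = ∀ k → 0 < k → k ≤ n → k ∣ L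

-- 1 / beta (a+1) b = 1 / beta a b − 1 / beta a (b+1): both right-hand fractions
-- have denominators dividing L, hence so does the left-hand one.
beta∣ : ∀ {n L} → CommonMultiple n L → ∀ a b → a + b < n → beta a b ∣ L
beta∣ {n} {L} cm zero b b<n = subst (_∣ L) (sym beta0) (cm (suc b) (s≤s z≤n) b<n)
  where
  beta0 : beta 0 b ≡ suc b
  beta0 = *-cancelʳ-≡ _ _ (b !) {{b !≢0}} (trans (cong (beta 0 b *_) (sym (*-identityˡ (b !)))) (beta-! 0 b))
beta∣ {n} {L} cm (suc a) b a+b<n
  with beta∣ cm a b (<-trans (n<1+n _) a+b<n) | beta∣ cm a (suc b) (subst (_< n) (sym (+-suc a b)) a+b<n)
... | divides x L≡xβ | divides y L≡yβ′ = divides (x ∸ y) (*-cancelʳ-≡ _ _ (suc a) (begin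
  L * suc a                               ≡⟨ cong (_* suc a) L≡xβ ⟩
  x * beta a b * suc a                    ≡⟨ regroup x (beta a b) (suc a) ⟩
  beta a b * (suc a * x)                  ≡⟨ cong (beta a b *_) diff ⟩
  beta a b * ((2 + (a + b)) * (x ∸ y))    ≡⟨ regroup₂ (beta a b) (2 + (a + b)) (x ∸ y) ⟩
  (x ∸ y) * (beta a b * (2 + (a + b)))    ≡⟨ cong ((x ∸ y) *_) (sym (beta-sucˡ a b)) ⟩
  (x ∸ y) * (beta (suc a) b * suc a)      ≡⟨ sym (*-assoc (x ∸ y) (beta (suc a) b) (suc a)) ⟩
  (x ∸ y) * beta (suc a) b * suc a        ∎))
  where
  open ≡-Reasoning
  regroup : ∀ x c k → x * c * k ≡ c * (k * x)
  regroup = solve-∀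
  regroup₂ : ∀ c k z → c * (k * z) ≡ z * (c * k)
  regroup₂ = solve-∀
  regroup₃ : ∀ c x k → c * (k * x) ≡ x * c * k
  regroup₃ = solve-∀
  split : ∀ a b x → (2 + (a + b)) * x ≡ suc a * x + suc b * x
  split = solve-∀
  -- Both sides are L (b + 1), up to the factor `beta a b`. Together with `split` this expresses (a
  -- + 1) x as a multiple of the difference of x and y.
  xy : suc b * x ≡ (2 + (a + b)) * y
  xy = *-cancelˡ-≡ _ _ (beta a b) {{>-nonZero (beta>0 a b)}} (begin
    beta a b * (suc b * x)            ≡⟨ regroup₃ (beta a b) x (suc b) ⟩
    x * beta a b * suc b              ≡⟨ cong (_* suc b) (sym L≡xβ) ⟩
    L * suc b                         ≡⟨ cong (_* suc b) L≡yβ′ ⟩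
    y * beta a (suc b) * suc b        ≡⟨ *-assoc y (beta a (suc b)) (suc b) ⟩
    y * (beta a (suc b) * suc b)      ≡⟨ cong (y *_) (beta-sucʳ a b) ⟩
    y * (beta a b * (2 + (a + b)))    ≡⟨ sym (regroup₂ (beta a b) (2 + (a + b)) y) ⟩
    beta a b * ((2 + (a + b)) * y)    ∎)
  diff : suc a * x ≡ (2 + (a + b)) * (x ∸ y)
  diff = begin
    suc a * x                                   ≡⟨ sym (m+n∸n≡m (suc a * x) (suc b * x)) ⟩
    suc a * x + suc b * x ∸ suc b * x           ≡⟨ cong₂ _∸_ (sym (split a b x)) xy ⟩
    (2 + (a + b)) * x ∸ (2 + (a + b)) * y       ≡⟨ sym (*-distribˡ-∸ (2 + (a + b)) x y) ⟩
    (2 + (a + b)) * (x ∸ y)                     ∎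

4^m≤commonMultiple : ∀ {m L} → 0 < L → CommonMultiple (suc (m + m)) L → 4 ^ m ≤ L
4^m≤commonMultiple {m} L>0 cm = ≤-trans (4^m≤beta m) (∣⇒≤ {{>-nonZero L>0}} (beta∣ cm m m ≤-refl))

-- Divisibility through prime powers

∃-prime-divisor : ∀ k → 1 < k → ∃ λ p → Prime p × p ∣ k
∃-prime-divisor = <-rec (λ k → 1 < k → ∃ λ p → Prime p × p ∣ k) step
  where
  step : ∀ k → (∀ {j} → j < k → 1 < j → ∃ λ p → Prime p × p ∣ j) → 1 < k → ∃ λ p → Prime p × p ∣ k
  step k rec 1<k with prime? k
  ... | yes pk = k , pk , ∣-refl
  ... | no ¬pk with ¬prime⇒composite {{n>1⇒nonTrivial 1<k}} ¬pk
  ...   | composite {d} d<k d∣k with rec d<k (nonTrivial⇒n>1 d)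
  ...     | p , pp , p∣d = p , pp , ∣-trans p∣d d∣k

extract-power : ∀ {p} → Prime p → ∀ k → 0 < k → ∃₂ λ e k′ → k ≡ p ^ e * k′ × p ∤ k′
extract-power {p} pp = <-rec (λ k → 0 < k → ∃₂ λ e k′ → k ≡ p ^ e * k′ × p ∤ k′) step
  where
  step : ∀ k → (∀ {j} → j < k → 0 < j → ∃₂ λ e k′ → j ≡ p ^ e * k′ × p ∤ k′) → 0 < k → ∃₂ λ e k′ → k ≡ p ^ e * k′ × p ∤ k′
  step k rec 0<k with p ∣? k
  ... | no p∤k = 0 , k , sym (*-identityˡ k) , p∤k
  ... | yes p∣k with rec (quotient-< p∣k {{prime⇒nonTrivial pp}} {{>-nonZero 0<k}}) (n≢0⇒n>0 (≢-nonZero⁻¹ _ {{quotient≢0 p∣k {{>-nonZero 0<k}}}}))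
  ...   | e , k′ , eq , p∤k′ = suc e , k′ , trans (m∣n⇒n≡m*quotient p∣k) (trans (cong (p *_) eq) (sym (*-assoc p (p ^ e) k′))) , p∤k′

coprime-*ʳ : ∀ {m a b} → Coprime m a → Coprime m b → Coprime m (a * b)
coprime-*ʳ ca cb (d∣m , d∣ab) = cb (d∣m , coprime-divisor (λ (c∣d , c∣a) → ca (∣-trans c∣d d∣m , c∣a)) d∣ab)

coprime-^ʳ : ∀ {m a} → Coprime m a → ∀ e → Coprime m (a ^ e)
coprime-^ʳ c zero (_ , d∣1) = ∣1⇒≡1 d∣1
coprime-^ʳ c (suc e) = coprime-*ʳ c (coprime-^ʳ c e)

prime∤⇒coprime : ∀ {p m} → Prime p → p ∤ m → Coprime m p
prime∤⇒coprime pp p∤m (d∣m , d∣p) with prime⇒irreducible pp d∣p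
... | inj₁ d≡1 = d≡1
... | inj₂ refl = contradiction d∣m p∤m

coprime-*-∣ : ∀ {a b L} → Coprime a b → a ∣ L → b ∣ L → a * b ∣ L
coprime-*-∣ {a} {b} cop a∣L (divides c refl) = *-monoˡ-∣ b (coprime-divisor cop (subst (a ∣_) (*-comm c b) a∣L))

-- Strong induction: split off the full power of one prime; it is coprime to the cofactor, so the
-- two may divide L separately.
∣-by-prime-powers : ∀ {L} k → 0 < k → (∀ p e → Prime p → p ^ e ∣ k → p ^ e ∣ L) → k ∣ L
∣-by-prime-powers {L} = <-rec (λ k → 0 < k → (∀ p e → Prime p → p ^ e ∣ k → p ^ e ∣ L) → k ∣ L) step
  where
  step : ∀ k → (∀ {j} → j < k → 0 < j → (∀ p e → Prime p → p ^ e ∣ j → p ^ e ∣ L) → j ∣ L) →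
         0 < k → (∀ p e → Prime p → p ^ e ∣ k → p ^ e ∣ L) → k ∣ L
  step 1 rec _ pows = 1∣ L
  step k@(suc (suc _)) rec 0<k pows with ∃-prime-divisor k (s≤s (s≤s z≤n))
  ... | p , pp , p∣k with extract-power pp k 0<k
  ...   | zero , k′ , eq , p∤k′ = contradiction (subst (p ∣_) (trans eq (*-identityˡ k′)) p∣k) p∤k′
  ...   | suc e , k′ , eq , p∤k′ = subst (_∣ L) (sym eq)
          (coprime-*-∣ (coprime-sym (coprime-^ʳ (prime∤⇒coprime pp p∤k′) (suc e)))
            (pows p (suc e) pp (divides k′ (trans eq (*-comm (p ^ suc e) k′))))
            (rec k′<k k′>0 λ r f pr r^f∣k′ → pows r f pr (∣-trans r^f∣k′ k′∣k)))
    where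
    k′∣k : k′ ∣ k
    k′∣k = divides (p ^ suc e) eq
    k′>0 : 0 < k′
    k′>0 = n≢0⇒n>0 λ { refl → p∤k′ (p ∣0) }
    k′<k : k′ < k
    k′<k = ≤∧≢⇒< (∣⇒≤ k′∣k) λ { refl → p∤k′ p∣k }

isqrt : ∀ n → ∃ λ s → s * s ≤ n × n < suc s * suc s
isqrt zero = 0 , z≤n , s≤s z≤n
isqrt (suc n) with isqrt n
... | s , s²≤n , n<s′² with suc s * suc s ≤? suc n
...   | yes s′²≤ = suc s , s′²≤ , ≤-trans (s≤s n<s′²) (*-mono-< {suc s} (n<1+n _) (n<1+n _))
...   | no s′²≰ = s , m≤n⇒m≤1+n s²≤n , ≰⇒> s′²≰

square-cancel-< : ∀ {a s} → a * a < suc s * suc s → a ≤ s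
square-cancel-< {a} {s} lt with a ≤? s
... | yes a≤s = a≤s
... | no a≰s = contradiction (*-mono-≤ (≰⇒> a≰s) (≰⇒> a≰s)) (<⇒≱ lt)

-- A prime power p ^ e ≤ N is p ^ (e mod 2) times the square of a prime power ≤ √N.
primes+roots⇒commonMultiple : ∀ {N s W Y} → N < suc s * suc s → (∀ p → Prime p → p ≤ N → p ∣ W) →
  CommonMultiple s Y → CommonMultiple N (W * (Y * Y))
primes+roots⇒commonMultiple {N} {s} {W} {Y} N< primes roots k 0<k k≤N = ∣-by-prime-powers k 0<k pows
  where
  root : ∀ p f → Prime p → p ^ f * p ^ f ≤ N → p ^ f ∣ Y
  root p f pp ≤N = roots (p ^ f) (m^n>0 p {{prime⇒nonZero pp}} f) (square-cancel-< (≤-<-trans ≤N N<))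
  swap : ∀ p x → x * (p * x) ≡ p * (x * x)
  swap = solve-∀
  pows : ∀ p e → Prime p → p ^ e ∣ k → p ^ e ∣ W * (Y * Y)
  pows p e pp p^e∣k with ≤-trans (∣⇒≤ {{>-nonZero 0<k}} p^e∣k) k≤N | half e
  ... | p^e≤N | double f rewrite ^-distribˡ-+-* p f f =
        ∣n⇒∣m*n W (*-pres-∣ (root p f pp p^e≤N) (root p f pp p^e≤N))
  ... | p^e≤N | double+1 f rewrite ^-distribˡ-+-* p f (suc f) | swap p (p ^ f) =
        *-pres-∣ (primes p pp (≤-trans (m≤m*n p _ {{m*n≢0 _ _ {{nz}} {{nz}}}}) p^e≤N)) (*-pres-∣ r r)
    where
    nz : NonZero (p ^ f)
    nz = m^n≢0 p f {{prime⇒nonZero pp}}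
    r : p ^ f ∣ Y
    r = root p f pp (≤-trans (m≤n*m _ p {{prime⇒nonZero pp}}) p^e≤N)

^-distribʳ-* : ∀ x y m → (x * y) ^ m ≡ x ^ m * y ^ m
^-distribʳ-* x y zero = refl
^-distribʳ-* x y (suc m) = trans (cong (x * y *_) (^-distribʳ-* x y m)) (interchange x y (x ^ m) (y ^ m))
  where
  interchange : ∀ x y u v → x * y * (u * v) ≡ x * u * (y * v)
  interchange = solve-∀

n!≤N^n : ∀ {N} n → n ≤ N → n ! ≤ N ^ n
n!≤N^n zero _ = ≤-refl
n!≤N^n (suc n) n<N = *-mono-≤ n<N (n!≤N^n n (<⇒≤ n<N))

CommonMultipleBound : ℕ → Set
CommonMultipleBound m = ∃ λ Y → 0 < Y × Y ≤ 16 ^ m × CommonMultiple m Y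

-- The same device of primes and roots, applied recursively to s = ⌊√m⌋, gives 4^m · 16^(2s) = 4^(m
-- + 4s). This is at most 16^m as soon as 4s ≤ s² ≤ m, that is for s ≥ 4; below 16 the factorial is
-- small enough.
commonMultiple-bound : ∀ m → CommonMultipleBound m
commonMultiple-bound = <-rec CommonMultipleBound step
  where
  open ≤-Reasoning
  step : ∀ m → (∀ {k} → k < m → CommonMultipleBound k) → CommonMultipleBound m
  step m rec with m ≤? 15
  ... | yes m≤15 = m ! , n!>0 m , n!≤N^n m (m≤n⇒m≤1+n m≤15) , λ k → m∣n!
  ... | no m≰15 with isqrt m
  ...   | s , s²≤m , m<s′² with s ≤? 3
  ...     | yes s≤3 = contradiction (≤-trans m<s′² (*-mono-≤ (s≤s s≤3) (s≤s s≤3))) (<⇒≱ (s≤s (≰⇒> m≰15)))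
  ...     | no s≰3 with rec s<m | primorial-bound m
    where
    s<m : s < m
    s<m = ≤-trans (m<m*n s s {{>-nonZero (≤-trans (s≤s z≤n) (≰⇒> s≰3))}} (≤-trans (s≤s (s≤s z≤n)) (≰⇒> s≰3))) s²≤m
  ...       | Y , Y>0 , Y≤ , cm | X , X>0 , X≤ , primes =
    X * (Y * Y) , *-mono-≤ X>0 (*-mono-≤ Y>0 Y>0) , bound , primes+roots⇒commonMultiple m<s′² primes cm
    where
    quad : ∀ s → s + s + (s + s) ≡ 4 * s
    quad = solve-∀
    bound : X * (Y * Y) ≤ 16 ^ m
    bound = begin
      X * (Y * Y)                          ≤⟨ *-mono-≤ X≤ (*-mono-≤ Y≤ Y≤) ⟩
      4 ^ m * (16 ^ s * 16 ^ s)            ≡⟨ cong (4 ^ m *_) (sym (^-distribˡ-+-* 16 s s)) ⟩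
      4 ^ m * 16 ^ (s + s)                 ≡⟨ cong (4 ^ m *_) (^-distribʳ-* 4 4 (s + s)) ⟩
      4 ^ m * (4 ^ (s + s) * 4 ^ (s + s))  ≡⟨ cong (4 ^ m *_) (sym (^-distribˡ-+-* 4 (s + s) (s + s))) ⟩
      4 ^ m * 4 ^ (s + s + (s + s))        ≡⟨ cong (λ x → 4 ^ m * 4 ^ x) (quad s) ⟩
      4 ^ m * 4 ^ (4 * s)                  ≤⟨ *-monoʳ-≤ (4 ^ m) (^-monoʳ-≤ 4 (≤-trans (*-monoˡ-≤ s (≰⇒> s≰3)) s²≤m)) ⟩
      4 ^ m * 4 ^ m                        ≡⟨ sym (^-distribʳ-* 4 4 m) ⟩
      16 ^ m                               ∎

-- Prime values of a progression

1+k≤2^k : ∀ k → suc k ≤ 2 ^ k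
1+k≤2^k zero = ≤-refl
1+k≤2^k (suc k) = begin
  suc (suc k)   ≤⟨ s≤s (m≤n+m (suc k) k) ⟩
  suc k + suc k ≡⟨ cong (suc k +_) (sym (+-identityʳ (suc k))) ⟩
  2 * suc k     ≤⟨ *-monoʳ-≤ 2 (1+k≤2^k k) ⟩
  2 ^ suc k     ∎
  where open ≤-Reasoning

PrimePart : ℕ → ℕ → Set
PrimePart r M = ∃₂ λ v E → M ! ≡ r ^ v * E × r ∤ E × r ^ v ≤ 2 ^ M

module _ {r′ : ℕ} (prime-r : Prime (suc r′)) where

  private
    r : ℕ
    r = suc r′

  ∤-* : ∀ {a b} → r ∤ a → r ∤ b → r ∤ a * b
  ∤-* {a} {b} r∤a r∤b r∣ab = [ r∤a , r∤b ]′ (euclidsLemma a b prime-r r∣ab)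

  -- The multiples of r among the factors contribute r^m · m!, and F collects the others. Passing
  -- from s = r - 1 to the next multiple of r splits off (m + 1) r.
  [s+mr]!-split : ∀ m s → s ≤ r′ → ∃ λ F → (s + m * r) ! ≡ F * (r ^ m * m !) × r ∤ F
  [s+mr]!-split zero zero _ = 1 , refl , λ r∣1 → ¬prime[1] (subst Prime (∣1⇒≡1 r∣1) prime-r)
  [s+mr]!-split (suc m) zero _ with [s+mr]!-split m r′ ≤-refl
  ... | F , eq , r∤F = F , trans (cong (suc (r′ + m * r) *_) eq) (regroup m r′ F (r ^ m) (m !)) , r∤F
    where
    regroup : ∀ m r′ F x y → suc (r′ + m * suc r′) * (F * (x * y)) ≡ F * (suc r′ * x * (suc m * y))
    regroup = solve-∀
  [s+mr]!-split m (suc s) s<r′ with [s+mr]!-split m s (<⇒≤ s<r′)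
  ... | F , eq , r∤F = (suc s + m * r) * F , trans (cong (suc (s + m * r) *_) eq) (sym (*-assoc (suc s + m * r) F _)) , ∤-* r∤ r∤F
    where
    r∤ : r ∤ suc s + m * r
    r∤ r∣ = <⇒≱ (s≤s s<r′) (∣⇒≤ (∣m+n∣m⇒∣n (subst (r ∣_) (+-comm (suc s) (m * r)) r∣) (n∣m*n m)))

  -- Legendre's formula as a recursion: with m = ⌊M / r⌋ the exponent is m plus the exponent of m!.
  -- As r ≤ 2^(r - 1), the bound becomes 2^((r - 1) m) · 2^m = 2^(r m) ≤ 2^M.
  primePart-suc : ∀ M → PrimePart r M
  primePart-suc = <-rec (PrimePart r) step
    where
    open ≤-Reasoning
    step : ∀ M → (∀ {k} → k < M → PrimePart r k) → PrimePart r M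
    step zero rec = 0 , 1 , refl , (λ r∣1 → ¬prime[1] (subst Prime (∣1⇒≡1 r∣1) prime-r)) , ≤-refl
    step M@(suc _) rec with rec (m/n<m M r (nonTrivial⇒n>1 r {{prime⇒nonTrivial prime-r}}))
                          | [s+mr]!-split (M / r) (M % r) (≤-pred (m%n<n M r))
    ... | v , E , eq , r∤E , ≤2^ | F , eq′ , r∤F = m + v , F * E , M!≡ , ∤-* r∤F r∤E , bound
      where
      m : ℕ
      m = M / r
      regroup : ∀ F x y E → F * (x * (y * E)) ≡ x * y * (F * E)
      regroup = solve-∀
      M!≡ : M ! ≡ r ^ (m + v) * (F * E)
      M!≡ = begin-equality
        M !                          ≡⟨ cong _! (m≡m%n+[m/n]*n M r) ⟩
        (M % r + m * r) !            ≡⟨ eq′ ⟩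
        F * (r ^ m * m !)            ≡⟨ cong (λ x → F * (r ^ m * x)) eq ⟩
        F * (r ^ m * (r ^ v * E))    ≡⟨ regroup F (r ^ m) (r ^ v) E ⟩
        r ^ m * r ^ v * (F * E)      ≡⟨ cong (_* (F * E)) (sym (^-distribˡ-+-* r m v)) ⟩
        r ^ (m + v) * (F * E)        ∎
      exponent : ∀ r′ m → r′ * m + m ≡ m * suc r′
      exponent = solve-∀
      bound : r ^ (m + v) ≤ 2 ^ M
      bound = begin
        r ^ (m + v)           ≡⟨ ^-distribˡ-+-* r m v ⟩
        r ^ m * r ^ v         ≤⟨ *-mono-≤ (^-monoˡ-≤ m (1+k≤2^k r′)) ≤2^ ⟩
        (2 ^ r′) ^ m * 2 ^ m  ≡⟨ cong (_* 2 ^ m) (^-*-assoc 2 r′ m) ⟩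
        2 ^ (r′ * m) * 2 ^ m  ≡⟨ sym (^-distribˡ-+-* 2 (r′ * m) m) ⟩
        2 ^ (r′ * m + m)      ≡⟨ cong (2 ^_) (exponent r′ m) ⟩
        2 ^ (m * r)           ≤⟨ ^-monoʳ-≤ 2 (≤-trans (m≤n+m (m * r) (M % r)) (≤-reflexive (sym (m≡m%n+[m/n]*n M r)))) ⟩
        2 ^ M                 ∎

primePart : ∀ {r} → Prime r → ∀ M → PrimePart r M
primePart {zero} pr = contradiction pr ¬prime[0]
primePart {suc _} pr = primePart-suc pr

CoprimePart : ℕ → ℕ → Set
CoprimePart q M = ∃₂ λ D E → M ! ≡ D * E × D ≤ 4 ^ M × Coprime E (2 * (q * q))

-- D = 2^v · q^w is the part of M! composed of 2 and q, each of which contributes at most 2^M.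
coprimePart : ∀ {q} → Prime q → 2 ∤ q → ∀ M → CoprimePart q M
coprimePart {q} pq 2∤q M with primePart prime[2] M | primePart pq M
... | v , E₁ , eq₁ , 2∤E₁ , 2^v≤ | w , E₂ , eq₂ , q∤E₂ , q^w≤ = go 2^v∣E₂
  where
  cop : Coprime (2 ^ v) (q ^ w)
  cop = coprime-^ʳ (coprime-sym (coprime-^ʳ (prime∤⇒coprime prime[2] 2∤q) v)) w
  2^v∣E₂ : 2 ^ v ∣ E₂
  2^v∣E₂ = coprime-divisor cop (divides E₁ (trans (sym eq₂) (trans eq₁ (*-comm (2 ^ v) E₁))))
  regroup : ∀ x y z → x * (y * z) ≡ z * x * y
  regroup = solve-∀
  4^M : 2 ^ M * 2 ^ M ≡ 4 ^ M
  4^M = trans (sym (^-distribˡ-+-* 2 M M)) (trans (cong (2 ^_) (cong (M +_) (sym (+-identityʳ M)))) (sym (^-*-assoc 2 2 M)))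
  go : 2 ^ v ∣ E₂ → CoprimePart q M
  go (divides E E₂≡) = 2 ^ v * q ^ w , E , M!≡ , subst (2 ^ v * q ^ w ≤_) 4^M (*-mono-≤ 2^v≤ q^w≤) ,
    coprime-*ʳ (prime∤⇒coprime prime[2] 2∤E) (coprime-*ʳ copq copq)
    where
    open ≡-Reasoning
    M!≡ : M ! ≡ 2 ^ v * q ^ w * E
    M!≡ = begin
      M !                     ≡⟨ eq₂ ⟩
      q ^ w * E₂              ≡⟨ cong (q ^ w *_) E₂≡ ⟩
      q ^ w * (E * 2 ^ v)     ≡⟨ regroup (q ^ w) E (2 ^ v) ⟩
      2 ^ v * q ^ w * E       ∎
    copq : Coprime E q
    copq = prime∤⇒coprime pq λ q∣E → q∤E₂ (subst (q ∣_) (sym E₂≡) (∣m⇒∣m*n (2 ^ v) q∣E))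
    2∤E : 2 ∤ E
    2∤E 2∣E = 2∤E₁ (subst (2 ∣_) (sym E₁≡) (∣n⇒∣m*n (q ^ w) 2∣E))
      where
      E₁≡ : E₁ ≡ q ^ w * E
      E₁≡ = *-cancelˡ-≡ _ _ (2 ^ v) {{m^n≢0 2 v}} (trans (sym eq₁) (trans M!≡ (*-assoc (2 ^ v) (q ^ w) E)))

prod : (ℕ → ℕ) → ℕ → ℕ
prod f zero = 1
prod f (suc M) = prod f M * f M

prod>0 : ∀ {f} → (∀ k → 0 < f k) → ∀ M → 0 < prod f M
prod>0 f>0 zero = s≤s z≤n
prod>0 f>0 (suc M) = *-mono-≤ (prod>0 f>0 M) (f>0 M)

prod-mono-≤ : ∀ {f g} → (∀ k → f k ≤ g k) → ∀ M → prod f M ≤ prod g M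
prod-mono-≤ f≤g zero = ≤-refl
prod-mono-≤ f≤g (suc M) = *-mono-≤ (prod-mono-≤ f≤g M) (f≤g M)

factor∣prod : ∀ f {k M} → k < M → f k ∣ prod f M
factor∣prod f {k} {suc M} k<1+M with m≤n⇒m<n∨m≡n (≤-pred k<1+M)
... | inj₁ k<M = ∣m⇒∣m*n (f M) (factor∣prod f k<M)
... | inj₂ refl = n∣m*n (prod f M)

prod-cong : ∀ {f g} → (∀ k → f k ≡ g k) → ∀ M → prod f M ≡ prod g M
prod-cong eq zero = refl
prod-cong eq (suc M) = cong₂ _*_ (prod-cong eq M) (eq M)

prod-scale : ∀ c f M → prod (λ k → c * f k) M ≡ c ^ M * prod f M
prod-scale c f zero = refl
prod-scale c f (suc M) = trans (cong (_* (c * f M)) (prod-scale c f M)) (regroup c (c ^ M) (prod f M) (f M))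
  where
  regroup : ∀ c x y z → x * y * (c * z) ≡ c * x * (y * z)
  regroup = solve-∀

prod-suc : ∀ M → prod suc M ≡ M !
prod-suc zero = refl
prod-suc (suc M) = trans (*-comm (prod suc M) (suc M)) (cong (suc M *_) (prod-suc M))

prod-shift : ∀ f E c M → ∃ λ z → prod (λ k → f k + E * c) M ≡ prod f M + E * z
prod-shift f E c zero = 0 , cong suc (sym (*-zeroʳ E))
prod-shift f E c (suc M) with prod-shift f E c M
... | z , eq = prod f M * c + z * (f M + E * c) , trans (cong (_* (f M + E * c)) eq) (regroup (prod f M) (f M) E c z)
  where
  regroup : ∀ x y E c z → (x + E * z) * (y + E * c) ≡ x * y + E * (x * c + z * (y + E * c))
  regroup = solve-∀

M!∣rising : ∀ b M → M ! ∣ prod (λ k → suc b + k) M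
M!∣rising b M = divides ((b + M) C b) (*-cancelʳ-≡ _ _ (b !) {{b !≢0}} (begin
  prod (λ k → suc b + k) M * b !        ≡⟨ rising-! M ⟩
  (b + M) !                             ≡⟨ sym (binom-! b M) ⟩
  ((b + M) C b) * (b ! * M !)           ≡⟨ regroup ((b + M) C b) (b !) (M !) ⟩
  ((b + M) C b) * M ! * b !             ∎))
  where
  open ≡-Reasoning
  regroup : ∀ x y z → x * (y * z) ≡ x * z * y
  regroup = solve-∀
  regroup₂ : ∀ x y z → x * y * z ≡ y * (x * z)
  regroup₂ = solve-∀
  rising-! : ∀ M → prod (λ k → suc b + k) M * b ! ≡ (b + M) !
  rising-! zero = trans (*-identityˡ (b !)) (cong _! (sym (+-identityʳ b)))
  rising-! (suc M) = begin
    prod (λ k → suc b + k) M * (suc b + M) * b !   ≡⟨ regroup₂ (prod (λ k → suc b + k) M) (suc b + M) (b !) ⟩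
    suc (b + M) * (prod (λ k → suc b + k) M * b !) ≡⟨ cong (suc (b + M) *_) (rising-! M) ⟩
    suc (b + M) * (b + M) !                        ≡⟨ cong _! (sym (+-suc b M)) ⟩
    (b + suc M) !                                  ∎

-- Modulo E the number d is invertible, so a is d times some residue, here taken positive as
-- `suc b`. Adding a multiple of E to a keeps the congruence within ℕ.
coprime-congruence : ∀ {E d} a → 0 < a → 0 < d → Coprime E d → ∃₂ λ b y → a + E * y ≡ d * suc b
coprime-congruence {E} {suc d} a@(suc a′) _ _ cop with coprime-Bézout cop
-- Here `x * E` is 1 modulo `suc d`, while -1 is wanted; the factor `d`, which is -1 modulo `suc d`,
-- corrects the sign.
... | Bézout.+- x y eq = a′ + a * y * d , a * x * d , (begin
  a + E * (a * x * d)           ≡⟨ regroup a E x d ⟩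
  a + x * E * (a * d)           ≡⟨ cong (λ t → a + t * (a * d)) (sym eq) ⟩
  a + (1 + y * suc d) * (a * d) ≡⟨ regroup₂ a′ y d ⟩
  suc d * suc (a′ + a * y * d)  ∎)
  where
  open ≡-Reasoning
  regroup : ∀ a E x d → a + E * (a * x * d) ≡ a + x * E * (a * d)
  regroup = solve-∀
  regroup₂ : ∀ a′ y d → suc a′ + (1 + y * suc d) * (suc a′ * d) ≡ suc d * suc (a′ + suc a′ * y * d)
  regroup₂ = solve-∀
... | Bézout.-+ x zero eq = contradiction eq λ ()
... | Bézout.-+ x (suc y) eq = y + a′ * suc y , a * x , (begin
  a + E * (a * x)         ≡⟨ regroup a E x ⟩
  a * (1 + x * E)         ≡⟨ cong (a *_) eq ⟩
  a * (suc y * suc d)     ≡⟨ regroup₂ a′ y d ⟩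
  suc d * suc (y + a′ * suc y) ∎)
  where
  open ≡-Reasoning
  regroup : ∀ a E x → a + E * (a * x) ≡ a * (1 + x * E)
  regroup = solve-∀
  regroup₂ : ∀ a′ y d → suc a′ * (suc y * suc d) ≡ suc d * suc (y + a′ * suc y)
  regroup₂ = solve-∀

-- Modulo E the progression a + k d is d times a run of consecutive integers.
∣prod-progression : ∀ {E a d M} → 0 < a → 0 < d → Coprime E d → E ∣ M ! → E ∣ prod (λ k → a + k * d) M
∣prod-progression {E} {a} {d} {M} a>0 d>0 cop E∣M! with coprime-congruence a a>0 d>0 cop
... | b , y , eq with prod-shift (λ k → a + k * d) E y M
...   | z , shift = ∣m+n∣m⇒∣n (subst (E ∣_) total E∣) (m∣m*n z)
  where
  open ≡-Reasoning
  E∣ : E ∣ d ^ M * prod (λ k → suc b + k) M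
  E∣ = ∣n⇒∣m*n (d ^ M) (∣-trans E∣M! (M!∣rising b M))
  swap : ∀ a k d e → d * suc b ≡ a + e → a + k * d + e ≡ d * (suc b + k)
  swap a k d e h = begin
    a + k * d + e       ≡⟨ regroup a (k * d) e ⟩
    a + e + k * d       ≡⟨ cong (_+ k * d) (sym h) ⟩
    d * suc b + k * d   ≡⟨ regroup₂ d (suc b) k ⟩
    d * (suc b + k)     ∎
    where
    regroup : ∀ x y z → x + y + z ≡ x + z + y
    regroup = solve-∀
    regroup₂ : ∀ d b k → d * b + k * d ≡ d * (b + k)
    regroup₂ = solve-∀
  total : d ^ M * prod (λ k → suc b + k) M ≡ E * z + prod (λ k → a + k * d) M
  total = begin
    d ^ M * prod (λ k → suc b + k) M      ≡⟨ sym (prod-scale d (λ k → suc b + k) M) ⟩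
    prod (λ k → d * (suc b + k)) M        ≡⟨ prod-cong (λ k → sym (swap a k d (E * y) (sym eq))) M ⟩
    prod (λ k → a + k * d + E * y) M      ≡⟨ shift ⟩
    prod (λ k → a + k * d) M + E * z      ≡⟨ +-comm _ (E * z) ⟩
    E * z + prod (λ k → a + k * d) M      ∎

-- n ≡ p + q² (2 t + 1) says that q² divides n − p with an odd quotient.
ProgressionCover : ℕ → ℕ → ℕ → Set
ProgressionCover n q M = ∃ λ Q → 0 < Q × Q ≤ (8 * (q * q)) ^ M ×
  (∀ p t → Prime p → M < p → n ≡ p + q * q * suc (2 * t) → p ∣ Q)

-- From n = p + q² (2t + 1) follows n + q² = p + (t + 1) d, so p is the term with index k = M - (t +
-- 1) of the progression starting at a. The terms are at most (k + 1) d, whence P ≤ d^M · M! and Q =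
-- P / E ≤ (4d)^M. A prime p > M does not divide M!, hence not E, so it divides Q.
coprimePart⇒cover : ∀ {n q a M} → Prime q → CoprimePart q M →
  n + q * q ≡ a + M * (2 * (q * q)) → 0 < a → a ≤ 2 * (q * q) →
  ProgressionCover n q M
coprimePart⇒cover {n} {q} {a} {M} pq (D , E , M!≡ , D≤ , cop) n≡ a>0 a≤d = go E∣P
  where
  open ≤-Reasoning
  d : ℕ
  d = 2 * (q * q)
  P : ℕ
  P = prod (λ k → a + k * d) M
  q>0 : 0 < q
  q>0 = prime>0 pq
  d>0 : 0 < d
  d>0 = *-mono-≤ {1} {2} (s≤s z≤n) (*-mono-≤ q>0 q>0)
  P>0 : 0 < P
  P>0 = prod>0 (λ k → ≤-trans a>0 (m≤m+n a (k * d))) M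
  E∣P : E ∣ P
  E∣P = ∣prod-progression {E} {a} {d} {M} a>0 d>0 cop (divides D M!≡)
  E>0 : 0 < E
  E>0 = n≢0⇒n>0 λ { refl → n>0⇒n≢0 (n!>0 M) (trans M!≡ (*-zeroʳ D)) }
  P≤ : P ≤ d ^ M * M !
  P≤ = begin
    P                              ≤⟨ prod-mono-≤ (λ k → +-monoˡ-≤ (k * d) a≤d) M ⟩
    prod (λ k → suc k * d) M       ≡⟨ prod-cong (λ k → *-comm (suc k) d) M ⟩
    prod (λ k → d * suc k) M       ≡⟨ prod-scale d suc M ⟩
    d ^ M * prod suc M             ≡⟨ cong (d ^ M *_) (prod-suc M) ⟩
    d ^ M * M !                    ∎
  d4 : ∀ x → 2 * x * 4 ≡ 8 * x
  d4 = solve-∀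
  go : E ∣ P → ProgressionCover n q M
  go (divides Q P≡) = Q , Q>0 , Q≤ , covers
    where
    Q>0 : 0 < Q
    Q>0 = n≢0⇒n>0 λ { refl → n>0⇒n≢0 P>0 P≡ }
    Q≤ : Q ≤ (8 * (q * q)) ^ M
    Q≤ = *-cancelʳ-≤ _ _ E {{>-nonZero E>0}} (begin
      Q * E                       ≡⟨ sym P≡ ⟩
      P                           ≤⟨ P≤ ⟩
      d ^ M * M !                 ≡⟨ cong (d ^ M *_) M!≡ ⟩
      d ^ M * (D * E)             ≤⟨ *-monoʳ-≤ (d ^ M) (*-monoˡ-≤ E D≤) ⟩
      d ^ M * (4 ^ M * E)         ≡⟨ sym (*-assoc (d ^ M) (4 ^ M) E) ⟩
      d ^ M * 4 ^ M * E           ≡⟨ cong (_* E) (sym (^-distribʳ-* d 4 M)) ⟩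
      (d * 4) ^ M * E             ≡⟨ cong (λ x → x ^ M * E) (d4 (q * q)) ⟩
      (8 * (q * q)) ^ M * E       ∎)
    covers : ∀ p t → Prime p → M < p → n ≡ p + q * q * suc (2 * t) → p ∣ Q
    covers p t pp M<p n≡p with euclidsLemma Q E pp (subst (p ∣_) P≡ p∣P)
      where
      regroup : ∀ p x t → p + x * suc (2 * t) + x ≡ p + suc t * (2 * x)
      regroup = solve-∀
      p+≡ : p + suc t * d ≡ a + M * d
      p+≡ = begin-equality
        p + suc t * d                    ≡⟨ sym (regroup p (q * q) t) ⟩
        p + q * q * suc (2 * t) + q * q  ≡⟨ cong (_+ q * q) (sym n≡p) ⟩
        n + q * q                        ≡⟨ n≡ ⟩
        a + M * d                        ∎
      t<M : suc t ≤ M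
      t<M with suc t ≤? M
      ... | yes t<M = t<M
      ... | no t≮M = contradiction (≤-reflexive p+≡) (<⇒≱ (begin-strict
        a + M * d          ≤⟨ +-monoˡ-≤ (M * d) a≤d ⟩
        suc M * d          ≤⟨ *-monoˡ-≤ d (≰⇒> t≮M) ⟩
        suc t * d          <⟨ m<n+m (suc t * d) (prime>0 pp) ⟩
        p + suc t * d      ∎))
      k : ℕ
      k = M ∸ suc t
      p≡ : p ≡ a + k * d
      p≡ = +-cancelʳ-≡ (suc t * d) p (a + k * d) (begin-equality
        p + suc t * d               ≡⟨ p+≡ ⟩
        a + M * d                   ≡⟨ cong (λ x → a + x * d) (sym (m∸n+n≡m t<M)) ⟩
        a + (k + suc t) * d         ≡⟨ cong (a +_) (*-distribʳ-+ d k (suc t)) ⟩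
        a + (k * d + suc t * d)     ≡⟨ sym (+-assoc a (k * d) (suc t * d)) ⟩
        a + k * d + suc t * d       ∎)
      p∣P : p ∣ P
      p∣P = subst (_∣ P) (sym p≡) (factor∣prod (λ k → a + k * d) (subst (k <_) (m∸n+n≡m t<M) (m<m+n k (s≤s z≤n))))
    ... | inj₁ p∣Q = p∣Q
    ... | inj₂ p∣E = contradiction (prime∣n!⇒p≤n pp M (∣-trans p∣E (divides D M!≡))) (<⇒≱ M<p)

progression-cover : ∀ {n q a M} → Prime q → 2 ∤ q → n + q * q ≡ a + M * (2 * (q * q)) → 0 < a → a ≤ 2 * (q * q) →
  ProgressionCover n q M
progression-cover {q = q} {M = M} pq 2∤q = coprimePart⇒cover pq (coprimePart pq 2∤q M)

-- Products over all moduli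

m<[1+m/n]*n : ∀ m n .{{_ : NonZero n}} → m < suc (m / n) * n
m<[1+m/n]*n m n = begin-strict
  m                  ≡⟨ m≡m%n+[m/n]*n m n ⟩
  m % n + m / n * n  <⟨ +-monoˡ-< (m / n * n) (m%n<n m n) ⟩
  suc (m / n) * n    ∎
  where open ≤-Reasoning

-- The loss from rounding the number of terms up to an integer, accumulated over `len` dyadic blocks
-- of moduli.
excess : ℕ → ℕ → ℕ
excess J zero = 0
excess J (suc len) = (7 + 2 * J) * 2 ^ J + excess (suc J) len

-- An entry (q , t , c) bounds log₂ (8q²) by t / u, and hence log₂ (8q²) / 2q² by c / (u v).
Entry : ℕ → ℕ → ℕ × ℕ × ℕ → Set
Entry u v (q , t , c) = 3 ≤ q × (8 * (q * q)) ^ u ≤ 2 ^ t × v * t ≤ c * (2 * (q * q))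

-- As M · 2q² ≤ n + q², a modulus costs c (n + q²) in the exponent; the part proportional to n is
-- kept apart from the constant part.
weight offset : List (ℕ × ℕ × ℕ) → ℕ
weight [] = 0
weight ((q , t , c) ∷ tab) = c + weight tab
offset [] = 0
offset ((q , t , c) ∷ tab) = c * (q * q) + offset tab

-- h bounds the lengths M of all progressions at once: M · 2q² ≤ n + q² means (2M - 1) q² ≤ n, and q
-- ≥ 3 then yields 18 M ≤ n + 9. So a prime p > h exceeds every M.
module Covering (n h : ℕ) (n+9<18h+18 : n + 9 < 18 * suc h) where

  -- Primality and oddness of q are premises here, so that 1 covers every other q and products may
  -- range over arbitrary lists of moduli.
  Covers : ℕ → ℕ → Set
  Covers q Z = Prime q → 2 ∤ q → ∀ p t → Prime p → h < p → n ≡ p + q * q * suc (2 * t) → p ∣ Z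

  covers-∣ : ∀ {q Z Z′} → Z ∣ Z′ → Covers q Z → Covers q Z′
  covers-∣ Z∣Z′ cov pq 2∤q p t pp h<p eq = ∣-trans (cov pq 2∤q p t pp h<p eq) Z∣Z′

  cover : ∀ q → 3 ≤ q → ∃₂ λ M Q → M * (2 * (q * q)) ≤ n + q * q × 0 < Q × Q ≤ (8 * (q * q)) ^ M × Covers q Q
  cover q 3≤q with prime? q
  ... | no ¬pq = 0 , 1 , z≤n , s≤s z≤n , s≤s z≤n , λ pq → contradiction pq ¬pq
  ... | yes pq with 2 ∣? q
  ...   | yes 2∣q = 0 , 1 , z≤n , s≤s z≤n , s≤s z≤n , λ _ 2∤q → contradiction 2∣q 2∤q
  ...   | no 2∤q = from (progression-cover pq 2∤q n+q²≡ (s≤s z≤n) (m%n<n x d))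
    where
    open ≤-Reasoning
    d x M : ℕ
    d = 2 * (q * q)
    -- Subtracting 1 before the division puts the residue `suc (x % d)` between 1 and d, so that the
    -- first term of the progression is positive.
    x = n + q * q ∸ 1
    q>0 : 0 < q
    q>0 = ≤-trans (s≤s z≤n) 3≤q
    instance
      d≢0 : NonZero d
      d≢0 = >-nonZero (*-mono-≤ {1} {2} (s≤s z≤n) (*-mono-≤ q>0 q>0))
    M = x / d
    suc-x : suc x ≡ n + q * q
    suc-x = trans (+-comm 1 x) (m∸n+n≡m (≤-trans (*-mono-≤ q>0 q>0) (m≤n+m (q * q) n)))
    n+q²≡ : n + q * q ≡ suc (x % d) + M * d
    n+q²≡ = trans (sym suc-x) (cong suc (m≡m%n+[m/n]*n x d))
    Md≤ : M * d ≤ n + q * q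
    Md≤ = subst (M * d ≤_) (sym n+q²≡) (m≤n+m (M * d) (suc (x % d)))
    M≤h : M ≤ h
    M≤h with M ≤? h
    ... | yes M≤h = M≤h
    ... | no M≰h = contradiction n+9<18h+18 (≤⇒≯ (begin
      18 * suc h        ≡⟨ regroup h ⟩
      h * 18 + 9 + 9    ≤⟨ +-monoˡ-≤ 9 (+-monoʳ-≤ (h * 18) (*-mono-≤ 3≤q 3≤q)) ⟩
      h * 18 + q * q + 9 ≤⟨ +-monoˡ-≤ 9 (+-cancelʳ-≤ (q * q) _ n (begin
        h * 18 + q * q + q * q    ≡⟨ regroup₂ h (q * q) ⟩
        h * (2 * 9) + 2 * (q * q) ≤⟨ +-monoˡ-≤ (2 * (q * q)) (*-monoʳ-≤ h (*-monoʳ-≤ 2 (*-mono-≤ 3≤q 3≤q))) ⟩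
        h * d + d                 ≡⟨ +-comm (h * d) d ⟩
        suc h * d                 ≤⟨ *-monoˡ-≤ d (≰⇒> M≰h) ⟩
        M * d                     ≤⟨ Md≤ ⟩
        n + q * q                 ∎)) ⟩
      n + 9             ∎))
      where
      regroup : ∀ h → 18 * suc h ≡ h * 18 + 9 + 9
      regroup = solve-∀
      regroup₂ : ∀ h y → h * 18 + y + y ≡ h * 18 + 2 * y
      regroup₂ = solve-∀
    from : ProgressionCover n q M →
           ∃₂ λ M Q → M * d ≤ n + q * q × 0 < Q × Q ≤ (8 * (q * q)) ^ M × Covers q Q
    from (Q , Q>0 , Q≤ , cov) = M , Q , Md≤ , Q>0 , Q≤ ,
      λ _ _ p t pp h<p eq → cov p t pp (≤-<-trans M≤h h<p) eq

  -- The exponents are rational with denominator u v; raising Z to the power `u * v` keeps them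
  -- integral.
  table-cover : ∀ u v tab → All (Entry u v) tab →
    ∃ λ Z → 0 < Z × Z ^ (u * v) ≤ 2 ^ (weight tab * n + offset tab) ×
      (∀ {q} → Any (λ e → proj₁ e ≡ q) tab → Covers q Z)
  table-cover u v [] [] = 1 , s≤s z≤n , ≤-reflexive (^-zeroˡ (u * v)) , λ ()
  table-cover u v ((q , t , c) ∷ tab) ((3≤q , ≤2^t , vt≤) ∷ entries) with cover q 3≤q | table-cover u v tab entries
  ... | M , Q , Md≤ , Q>0 , Q≤ , cov | Z , Z>0 , Z≤ , covs = Q * Z , *-mono-≤ Q>0 Z>0 , bound , all-cov
    where
    open ≤-Reasoning
    regroup : ∀ u m v → m * (u * v) ≡ u * (m * v)
    regroup = solve-∀
    regroup₂ : ∀ t m v → t * (m * v) ≡ v * t * m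
    regroup₂ = solve-∀
    regroup₃ : ∀ c d m → c * d * m ≡ c * (m * d)
    regroup₃ = solve-∀
    collect : ∀ c n y w o → c * (n + y) + (w * n + o) ≡ (c + w) * n + (c * y + o)
    collect = solve-∀
    exponent : t * (M * v) ≤ c * (n + q * q)
    exponent = begin
      t * (M * v)               ≡⟨ regroup₂ t M v ⟩
      v * t * M                 ≤⟨ *-monoˡ-≤ M vt≤ ⟩
      c * (2 * (q * q)) * M     ≡⟨ regroup₃ c (2 * (q * q)) M ⟩
      c * (M * (2 * (q * q)))   ≤⟨ *-monoʳ-≤ c Md≤ ⟩
      c * (n + q * q)           ∎
    Q^≤ : Q ^ (u * v) ≤ 2 ^ (c * (n + q * q))
    Q^≤ = begin
      Q ^ (u * v)                          ≤⟨ ^-monoˡ-≤ (u * v) Q≤ ⟩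
      ((8 * (q * q)) ^ M) ^ (u * v)        ≡⟨ ^-*-assoc (8 * (q * q)) M (u * v) ⟩
      (8 * (q * q)) ^ (M * (u * v))        ≡⟨ cong ((8 * (q * q)) ^_) (regroup u M v) ⟩
      (8 * (q * q)) ^ (u * (M * v))        ≡⟨ sym (^-*-assoc (8 * (q * q)) u (M * v)) ⟩
      ((8 * (q * q)) ^ u) ^ (M * v)        ≤⟨ ^-monoˡ-≤ (M * v) ≤2^t ⟩
      (2 ^ t) ^ (M * v)                     ≡⟨ ^-*-assoc 2 t (M * v) ⟩
      2 ^ (t * (M * v))                     ≤⟨ ^-monoʳ-≤ 2 exponent ⟩
      2 ^ (c * (n + q * q))                 ∎
    bound : (Q * Z) ^ (u * v) ≤ 2 ^ ((c + weight tab) * n + (c * (q * q) + offset tab))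
    bound = begin
      (Q * Z) ^ (u * v)                    ≡⟨ ^-distribʳ-* Q Z (u * v) ⟩
      Q ^ (u * v) * Z ^ (u * v)           ≤⟨ *-mono-≤ Q^≤ Z≤ ⟩
      2 ^ (c * (n + q * q)) * 2 ^ (weight tab * n + offset tab) ≡⟨ sym (^-distribˡ-+-* 2 (c * (n + q * q)) _) ⟩
      2 ^ (c * (n + q * q) + (weight tab * n + offset tab)) ≡⟨ cong (2 ^_) (collect c n (q * q) (weight tab) (offset tab)) ⟩
      2 ^ ((c + weight tab) * n + (c * (q * q) + offset tab)) ∎
    all-cov : ∀ {q′} → Any (λ e → proj₁ e ≡ q′) ((q , t , c) ∷ tab) → Covers q′ (Q * Z)
    all-cov (here refl) = covers-∣ (m∣m*n Z) cov
    all-cov (there e) = covers-∣ (n∣m*n Q) (covs e)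

  interval-cover : ∀ {B lo} len → (∀ i → lo ≤ i → i < lo + len → ∃ λ Q → 0 < Q × Q ≤ B × Covers (suc (2 * i)) Q) →
    ∃ λ Z → 0 < Z × Z ≤ B ^ len × (∀ i → lo ≤ i → i < lo + len → Covers (suc (2 * i)) Z)
  interval-cover {lo = lo} zero each = 1 , s≤s z≤n , ≤-refl ,
    λ i lo≤i i<lo → contradiction (subst (i <_) (+-identityʳ lo) i<lo) (≤⇒≯ lo≤i)
  interval-cover {B} {lo} (suc len) each
    with each (lo + len) (m≤m+n lo len) (≤-reflexive (sym (+-suc lo len)))
       | interval-cover {B} {lo} len (λ i lo≤i i< → each i lo≤i (<-trans i< (+-monoʳ-< lo (n<1+n len))))
  ... | Q , Q>0 , Q≤ , cov | Z , Z>0 , Z≤ , covs = Q * Z , *-mono-≤ Q>0 Z>0 , *-mono-≤ Q≤ Z≤ , all-cov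
    where
    all-cov : ∀ i → lo ≤ i → i < lo + suc len → Covers (suc (2 * i)) (Q * Z)
    all-cov i lo≤i i< with m≤n⇒m<n∨m≡n (≤-pred (subst (i <_) (+-suc lo len) i<))
    ... | inj₁ i<′ = covers-∣ (n∣m*n Q) (covs i lo≤i i<′)
    ... | inj₂ refl = covers-∣ (m∣m*n Z) cov

  -- With w = 2^j the block has w odd moduli q between 2w and 4w, each charged as if prime. So 8q² ≤
  -- 2^(7 + 2j), and since x + 1 exceeds n / 8w, each length M is at most y = ⌊x / w⌋ + 1. In total
  -- w y ≤ x + w.
  dyadic-cover : ∀ j x → 0 < j → n < suc x * 2 ^ (3 + j) →
    ∃ λ Z → 0 < Z × Z ≤ 2 ^ ((7 + 2 * j) * (x + 2 ^ j)) ×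
      (∀ i → 2 ^ j ≤ i → i < 2 ^ suc j → Covers (suc (2 * i)) Z)
  dyadic-cover j x 0<j n< = finish (interval-cover {2 ^ ((7 + 2 * j) * y)} {w} w each)
    where
    open ≤-Reasoning
    w y : ℕ
    w = 2 ^ j
    instance
      w≢0 : NonZero w
      w≢0 = m^n≢0 2 j
    y = (x + w) / w
    each : ∀ i → w ≤ i → i < w + w → ∃ λ Q → 0 < Q × Q ≤ 2 ^ ((7 + 2 * j) * y) × Covers (suc (2 * i)) Q
    each i w≤i i<2w with cover (suc (2 * i)) (s≤s (*-monoʳ-≤ 2 (≤-trans (m^n>0 2 j) w≤i)))
    ... | M , Q , Md≤ , Q>0 , Q≤ , cov = Q , Q>0 , Q≤2^ , cov
      where
      q : ℕ
      q = suc (2 * i)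
      q≤4w : q ≤ 2 * (2 * w)
      q≤4w = begin
        suc (2 * i)         ≤⟨ n≤1+n _ ⟩
        2 + 2 * i           ≡⟨ sym (*-suc 2 i) ⟩
        2 * suc i           ≤⟨ *-monoʳ-≤ 2 i<2w ⟩
        2 * (w + w)         ≡⟨ cong (λ z → 2 * (w + z)) (sym (+-identityʳ w)) ⟩
        2 * (2 * w)         ∎
      2w≤q : 2 * w ≤ q
      2w≤q = m≤n⇒m≤1+n (*-monoʳ-≤ 2 w≤i)
      8q²≤ : 8 * (q * q) ≤ 2 ^ (7 + 2 * j)
      8q²≤ = begin
        8 * (q * q)                              ≤⟨ *-monoʳ-≤ 8 (*-mono-≤ q≤4w q≤4w) ⟩
        8 * (2 * (2 * w) * (2 * (2 * w)))        ≡⟨ regroup w ⟩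
        128 * (w * w)                            ≡⟨ cong (128 *_) (sym (^-distribˡ-+-* 2 j j)) ⟩
        128 * 2 ^ (j + j)                        ≡⟨ cong (λ z → 128 * 2 ^ (j + z)) (sym (+-identityʳ j)) ⟩
        128 * 2 ^ (2 * j)                        ≡⟨ sym (^-distribˡ-+-* 2 7 (2 * j)) ⟩
        2 ^ (7 + 2 * j)                          ∎
        where
        regroup : ∀ w → 8 * (2 * (2 * w) * (2 * (2 * w))) ≡ 128 * (w * w)
        regroup = solve-∀
      Mw≤ : ∀ M → M * (2 * (q * q)) ≤ n + q * q → M * w ≤ x + w
      Mw≤ zero _ = z≤n
      -- Giving up one term absorbs the summand q²: M′ · 2q² ≤ n - q².
      Mw≤ (suc M′) Md≤ with M′ * w ≤? x
      ... | yes ≤x = subst (_≤ x + w) (+-comm (M′ * w) w) (+-monoˡ-≤ w ≤x)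
      ... | no ≰x = contradiction n< (≤⇒≯ (begin
        suc x * 2 ^ (3 + j)             ≤⟨ *-monoˡ-≤ (2 ^ (3 + j)) (≰⇒> ≰x) ⟩
        M′ * w * (2 * (2 * (2 * w)))    ≡⟨ regroup M′ w ⟩
        M′ * (2 * (2 * w * (2 * w)))    ≤⟨ *-monoʳ-≤ M′ (*-monoʳ-≤ 2 (*-mono-≤ 2w≤q 2w≤q)) ⟩
        M′ * (2 * (q * q))              ≤⟨ +-cancelʳ-≤ (q * q) _ n (begin
          M′ * (2 * (q * q)) + q * q        ≤⟨ +-monoʳ-≤ (M′ * (2 * (q * q))) (m≤m+n (q * q) (q * q + 0)) ⟩
          M′ * (2 * (q * q)) + 2 * (q * q)  ≡⟨ +-comm (M′ * (2 * (q * q))) (2 * (q * q)) ⟩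
          suc M′ * (2 * (q * q))            ≤⟨ Md≤ ⟩
          n + q * q                         ∎) ⟩
        n                               ∎))
        where
        regroup : ∀ m w → m * w * (2 * (2 * (2 * w))) ≡ m * (2 * (2 * w * (2 * w)))
        regroup = solve-∀
      M≤y : M ≤ y
      M≤y = subst (_≤ y) (m*n/n≡m M w) (/-monoˡ-≤ w (Mw≤ M Md≤))
      Q≤2^ : Q ≤ 2 ^ ((7 + 2 * j) * y)
      Q≤2^ = begin
        Q                           ≤⟨ Q≤ ⟩
        (8 * (q * q)) ^ M           ≤⟨ ^-monoˡ-≤ M 8q²≤ ⟩
        (2 ^ (7 + 2 * j)) ^ M       ≡⟨ ^-*-assoc 2 (7 + 2 * j) M ⟩
        2 ^ ((7 + 2 * j) * M)       ≤⟨ ^-monoʳ-≤ 2 (*-monoʳ-≤ (7 + 2 * j) M≤y) ⟩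
        2 ^ ((7 + 2 * j) * y)       ∎
    finish : (∃ λ Z → 0 < Z × Z ≤ (2 ^ ((7 + 2 * j) * y)) ^ w × (∀ i → w ≤ i → i < w + w → Covers (suc (2 * i)) Z)) →
      ∃ λ Z → 0 < Z × Z ≤ 2 ^ ((7 + 2 * j) * (x + w)) × (∀ i → w ≤ i → i < 2 * w → Covers (suc (2 * i)) Z)
    finish (Z , Z>0 , Z≤ , covs) = Z , Z>0 , bound ,
      λ i w≤i i<2w → covs i w≤i (subst (i <_) (cong (w +_) (+-identityʳ w)) i<2w)
      where
      bound : Z ≤ 2 ^ ((7 + 2 * j) * (x + w))
      bound = begin
        Z                                 ≤⟨ Z≤ ⟩
        (2 ^ ((7 + 2 * j) * y)) ^ w       ≡⟨ ^-*-assoc 2 ((7 + 2 * j) * y) w ⟩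
        2 ^ ((7 + 2 * j) * y * w)         ≡⟨ cong (2 ^_) (*-assoc (7 + 2 * j) y w) ⟩
        2 ^ ((7 + 2 * j) * (y * w))       ≤⟨ ^-monoʳ-≤ 2 (*-monoʳ-≤ (7 + 2 * j) (m/n*n≤m (x + w) w)) ⟩
        2 ^ ((7 + 2 * j) * (x + w))       ∎

  -- The main terms are summed with Σ_{j≥J} (2j + 7) / 2^(j−J) = 4J + 18.
  tail-cover : ∀ len J x → 0 < J → n < suc x * 2 ^ (3 + J) →
    ∃ λ Z → 0 < Z × Z ≤ 2 ^ (x * (18 + 4 * J) + excess J len) ×
      (∀ i → 2 ^ J ≤ i → i < 2 ^ (J + len) → Covers (suc (2 * i)) Z)
  tail-cover zero J x _ _ = 1 , s≤s z≤n , m^n>0 2 (x * (18 + 4 * J) + 0) ,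
    λ i ≤i i< → contradiction (subst (λ k → i < 2 ^ k) (+-identityʳ J) i<) (≤⇒≯ ≤i)
  tail-cover (suc len) J x 0<J n< = split (halved x)
    where
    open ≤-Reasoning
    -- Passing to the next block halves x, rounding down; x + 1 ≤ 2 (y + 1) preserves the strict
    -- bound on n.
    halved : ∀ x → ∃ λ y → y + y ≤ x × x ≤ suc (y + y)
    halved x with half x
    ... | double y = y , ≤-refl , n≤1+n _
    ... | double+1 y = y , +-monoʳ-≤ y (n≤1+n y) , ≤-reflexive (+-suc y y)
    e : ℕ
    e = excess (suc J) len
    regroup : ∀ J x w y e → (7 + 2 * J) * (x + w) + (y * (18 + 4 * suc J) + e) ≡ (7 + 2 * J) * x + (y + y) * (11 + 2 * J) + ((7 + 2 * J) * w + e)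
    regroup = solve-∀
    regroup₂ : ∀ J x → (7 + 2 * J) * x + x * (11 + 2 * J) ≡ x * (18 + 4 * J)
    regroup₂ = solve-∀
    regroup₃ : ∀ y z → suc (suc (y + y)) * z ≡ suc y * (2 * z)
    regroup₃ = solve-∀
    exponent : ∀ y → y + y ≤ x →
      (7 + 2 * J) * (x + 2 ^ J) + (y * (18 + 4 * suc J) + e) ≤ x * (18 + 4 * J) + ((7 + 2 * J) * 2 ^ J + e)
    exponent y 2y≤x = begin
      (7 + 2 * J) * (x + 2 ^ J) + (y * (18 + 4 * suc J) + e)                ≡⟨ regroup J x (2 ^ J) y e ⟩
      (7 + 2 * J) * x + (y + y) * (11 + 2 * J) + ((7 + 2 * J) * 2 ^ J + e)  ≤⟨ +-monoˡ-≤ _ (+-monoʳ-≤ ((7 + 2 * J) * x) (*-monoˡ-≤ (11 + 2 * J) 2y≤x)) ⟩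
      (7 + 2 * J) * x + x * (11 + 2 * J) + ((7 + 2 * J) * 2 ^ J + e)        ≡⟨ cong (_+ ((7 + 2 * J) * 2 ^ J + e)) (regroup₂ J x) ⟩
      x * (18 + 4 * J) + ((7 + 2 * J) * 2 ^ J + e)                          ∎
    combine : ∀ y → y + y ≤ x →
      (∃ λ Z → 0 < Z × Z ≤ 2 ^ ((7 + 2 * J) * (x + 2 ^ J)) ×
        (∀ i → 2 ^ J ≤ i → i < 2 ^ suc J → Covers (suc (2 * i)) Z)) →
      (∃ λ Z → 0 < Z × Z ≤ 2 ^ (y * (18 + 4 * suc J) + e) ×
        (∀ i → 2 ^ suc J ≤ i → i < 2 ^ (suc J + len) → Covers (suc (2 * i)) Z)) →
      ∃ λ Z → 0 < Z × Z ≤ 2 ^ (x * (18 + 4 * J) + excess J (suc len)) ×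
        (∀ i → 2 ^ J ≤ i → i < 2 ^ (J + suc len) → Covers (suc (2 * i)) Z)
    combine y 2y≤x (Z₁ , Z₁>0 , Z₁≤ , cov₁) (Z₂ , Z₂>0 , Z₂≤ , cov₂) =
      Z₁ * Z₂ , *-mono-≤ Z₁>0 Z₂>0 , bound , all-cov
      where
      bound : Z₁ * Z₂ ≤ 2 ^ (x * (18 + 4 * J) + ((7 + 2 * J) * 2 ^ J + e))
      bound = begin
        Z₁ * Z₂                                                           ≤⟨ *-mono-≤ Z₁≤ Z₂≤ ⟩
        2 ^ ((7 + 2 * J) * (x + 2 ^ J)) * 2 ^ (y * (18 + 4 * suc J) + e)  ≡⟨ sym (^-distribˡ-+-* 2 ((7 + 2 * J) * (x + 2 ^ J)) (y * (18 + 4 * suc J) + e)) ⟩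
        2 ^ ((7 + 2 * J) * (x + 2 ^ J) + (y * (18 + 4 * suc J) + e))      ≤⟨ ^-monoʳ-≤ 2 (exponent y 2y≤x) ⟩
        2 ^ (x * (18 + 4 * J) + ((7 + 2 * J) * 2 ^ J + e))                ∎
      all-cov : ∀ i → 2 ^ J ≤ i → i < 2 ^ (J + suc len) → Covers (suc (2 * i)) (Z₁ * Z₂)
      all-cov i 2^J≤i i< with i <? 2 ^ suc J
      ... | yes i<2^ = covers-∣ (m∣m*n Z₂) (cov₁ i 2^J≤i i<2^)
      ... | no i≮2^ = covers-∣ (n∣m*n Z₁) (cov₂ i (≮⇒≥ i≮2^) (subst (λ k → i < 2 ^ k) (+-suc J len) i<))
    split : (∃ λ y → y + y ≤ x × x ≤ suc (y + y)) →
      ∃ λ Z → 0 < Z × Z ≤ 2 ^ (x * (18 + 4 * J) + excess J (suc len)) ×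
        (∀ i → 2 ^ J ≤ i → i < 2 ^ (J + suc len) → Covers (suc (2 * i)) Z)
    split (y , 2y≤x , x≤2y+1) = combine y 2y≤x (dyadic-cover J x 0<J n<) (tail-cover len (suc J) y (s≤s z≤n) n<′)
      where
      n<′ : n < suc y * 2 ^ (4 + J)
      n<′ = begin-strict
        n                                   <⟨ n< ⟩
        suc x * 2 ^ (3 + J)                 ≤⟨ *-monoˡ-≤ (2 ^ (3 + J)) (s≤s x≤2y+1) ⟩
        suc (suc (y + y)) * 2 ^ (3 + J)     ≡⟨ regroup₃ y (2 ^ (3 + J)) ⟩
        suc y * 2 ^ (4 + J)                 ∎

-- Numerical estimates of the exponents

-- Telescoping: (7 + 2j) 2^j is the increment of 2^j (3 + 2j) from j to j + 1.
excess-closed : ∀ J len → excess J len + 2 ^ J * (3 + 2 * J) ≡ 2 ^ (J + len) * (3 + 2 * (J + len))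
excess-closed J zero = cong (λ k → 2 ^ k * (3 + 2 * k)) (sym (+-identityʳ J))
excess-closed J (suc len) = begin
  (7 + 2 * J) * 2 ^ J + excess (suc J) len + 2 ^ J * (3 + 2 * J)    ≡⟨ regroup J (2 ^ J) (excess (suc J) len) ⟩
  excess (suc J) len + 2 ^ suc J * (3 + 2 * suc J)                ≡⟨ excess-closed (suc J) len ⟩
  2 ^ (suc J + len) * (3 + 2 * (suc J + len))                     ≡⟨ cong (λ k → 2 ^ k * (3 + 2 * k)) (sym (+-suc J len)) ⟩
  2 ^ (J + suc len) * (3 + 2 * (J + suc len))                     ∎
  where
  open ≡-Reasoning
  regroup : ∀ J w e → (7 + 2 * J) * w + e + w * (3 + 2 * J) ≡ e + 2 * w * (3 + 2 * suc J)
  regroup = solve-∀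

2len≤2^len : ∀ len → 2 * len ≤ 2 ^ len
2len≤2^len zero = z≤n
2len≤2^len (suc k) = *-monoʳ-≤ 2 (1+k≤2^k k)

-- The quadratic 5v² - 19v + 19 has negative discriminant 361 - 380. In ℕ, the values below 4 are
-- evaluated and 19 ≤ 5 · 4 settles the rest.
19v≤5v²+19 : ∀ v → 19 * v ≤ 5 * (v * v) + 19
19v≤5v²+19 0 = z≤n
19v≤5v²+19 1 = ≤ᵇ⇒≤ 19 24 _
19v≤5v²+19 2 = ≤ᵇ⇒≤ 38 39 _
19v≤5v²+19 3 = ≤ᵇ⇒≤ 57 64 _
19v≤5v²+19 v@(suc (suc (suc (suc v′)))) = begin
  19 * v            ≤⟨ *-monoˡ-≤ v (n≤1+n 19) ⟩
  20 * v            ≡⟨ *-assoc 5 4 v ⟩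
  5 * (4 * v)       ≤⟨ *-monoʳ-≤ 5 (*-monoˡ-≤ v (m≤m+n 4 v′)) ⟩
  5 * (v * v)       ≤⟨ m≤m+n _ 19 ⟩
  5 * (v * v) + 19  ∎
  where open ≤-Reasoning

excess≤ : ∀ len → 128 * excess 8 len ≤ 3 * (2 ^ (8 + len) * 2 ^ (8 + len))
excess≤ len = begin
  128 * excess 8 len                        ≤⟨ *-monoʳ-≤ 128 e≤ ⟩
  128 * (1536 * (v * v))                    ≡⟨ trans (sym (*-assoc 128 1536 (v * v))) (regroup 256 v) ⟩
  3 * (256 * v * (256 * v))                 ≡⟨ cong (λ z → 3 * (z * z)) (sym (^-distribˡ-+-* 2 8 len)) ⟩
  3 * (2 ^ (8 + len) * 2 ^ (8 + len))       ∎
  where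
  open ≤-Reasoning
  v : ℕ
  v = 2 ^ len
  regroup : ∀ k v → 3 * k * k * (v * v) ≡ 3 * (k * v * (k * v))
  regroup = solve-∀
  regroup₂ : ∀ len v → v * (3 + 2 * (8 + len)) ≡ v * (2 * len) + 19 * v
  regroup₂ = solve-∀
  regroup₃ : ∀ v → 256 * (v * v + (5 * (v * v) + 19)) ≡ 1536 * (v * v) + 4864
  regroup₃ = solve-∀
  e≤ : excess 8 len ≤ 1536 * (v * v)
  -- 4864 = 256 · 19 is the boundary term 2^J (3 + 2J) at J = 8.
  e≤ = +-cancelʳ-≤ 4864 _ _ (begin
    excess 8 len + 4864                       ≡⟨ excess-closed 8 len ⟩
    2 ^ (8 + len) * (3 + 2 * (8 + len))       ≡⟨ cong (_* (3 + 2 * (8 + len))) (^-distribˡ-+-* 2 8 len) ⟩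
    256 * v * (3 + 2 * (8 + len))             ≡⟨ *-assoc 256 v (3 + 2 * (8 + len)) ⟩
    256 * (v * (3 + 2 * (8 + len)))           ≡⟨ cong (256 *_) (regroup₂ len v) ⟩
    256 * (v * (2 * len) + 19 * v)            ≤⟨ *-monoʳ-≤ 256 (+-mono-≤ (*-monoʳ-≤ v (2len≤2^len len)) (19v≤5v²+19 v)) ⟩
    256 * (v * v + (5 * (v * v) + 19))        ≡⟨ regroup₃ v ⟩
    1536 * (v * v) + 4864                     ∎)

-- The blocks must reach all q ≤ s without overshooting: 2^(b + len) ≤ s ≤ √n lets `excess≤` bound
-- the loss by 3n / 128. If `len` is 0 there are no blocks and no loss.
dyadic-size : ∀ b s → ∃ λ len → s < 2 ^ suc (b + len) × (len ≡ 0 ⊎ 2 ^ (b + len) ≤ s)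
dyadic-size b zero = 0 , m^n>0 2 (suc (b + 0)) , inj₁ refl
dyadic-size b (suc s) with dyadic-size b s
... | len , s< , bound with suc s <? 2 ^ suc (b + len)
...   | yes s′< = len , s′< , Sum.map₂ m≤n⇒m≤1+n bound
...   | no s′≮ = suc len , s′<′ , inj₂ (subst (λ k → 2 ^ k ≤ suc s) (sym (+-suc b len)) (≮⇒≥ s′≮))
  where
  open ≤-Reasoning
  w : ℕ
  w = 2 ^ suc (b + len)
  s′<′ : suc s < 2 ^ suc (b + suc len)
  s′<′ = begin-strict
    suc s               ≤⟨ s< ⟩
    w                   <⟨ m<m+n w (m^n>0 2 (suc (b + len))) ⟩
    w + w               ≡⟨ cong (w +_) (sym (+-identityʳ w)) ⟩
    2 * w               ≡⟨ cong (λ k → 2 * 2 ^ k) (sym (+-suc b len)) ⟩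
    2 ^ suc (b + suc len) ∎

^-cancelʳ-≤ : ∀ {a b} → 2 ^ a ≤ 2 ^ b → a ≤ b
^-cancelʳ-≤ {a} {b} 2^a≤2^b with a ≤? b
... | yes a≤b = a≤b
... | no a≰b = contradiction 2^a≤2^b (<⇒≱ (^-monoʳ-< 2 (s≤s (s≤s z≤n)) (≰⇒> a≰b)))

-- The inequality at N forces β ≤ α, so it persists; one numerical comparison at 65536 thereby
-- settles all larger n.
linear-< : ∀ {α β γ N n} → β * N + γ < α * N → N ≤ n → β * n + γ < α * n
linear-< {α} {β} {γ} {N} {n} lt N≤n = begin-strict
  β * n + γ                       ≡⟨ cong (λ k → β * k + γ) (sym (m+[n∸m]≡n N≤n)) ⟩
  β * (N + (n ∸ N)) + γ           ≡⟨ regroup β N (n ∸ N) γ ⟩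
  β * N + γ + β * (n ∸ N)         <⟨ +-mono-<-≤ lt (*-monoˡ-≤ (n ∸ N) β≤α) ⟩
  α * N + α * (n ∸ N)             ≡⟨ sym (*-distribˡ-+ α N (n ∸ N)) ⟩
  α * (N + (n ∸ N))               ≡⟨ cong (α *_) (m+[n∸m]≡n N≤n) ⟩
  α * n                           ∎
  where
  open ≤-Reasoning
  regroup : ∀ β N r γ → β * (N + r) + γ ≡ β * N + γ + β * r
  regroup = solve-∀
  β≤α : β ≤ α
  β≤α = <⇒≤ (*-cancelʳ-< N β α (≤-<-trans (m≤m+n (β * N) γ) lt))

-- 9216 = 9 · 1024 clears the denominators of h ≤ (n + 9) / 18, x ≤ n / 2048, e ≤ 3n / 128 and s ≤ n / 256.
exponents-contradict : ∀ {K n m h x e s ω ω′} → n ≡ 2 + (m + m) → 65536 ≤ n →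
  18 * h ≤ n + 9 → 2048 * x ≤ n → 128 * e ≤ 3 * n → 256 * s ≤ n →
  (m + m) * K ≤ ω * n + ω′ + (2 * h + (x * 50 + e) + 8 * s) * K →
  ¬ ((1753 * K + 9216 * ω) * 65536 + (27648 * K + 9216 * ω′) < 9216 * K * 65536)
exponents-contradict {K} {n} {m} {h} {x} {e} {s} {ω} {ω′} n≡ n≥ h≤ x≤ e≤ s≤ main numbers =
  <⇒≱ (linear-< {9216 * K} {1753 * K + 9216 * ω} {27648 * K + 9216 * ω′} numbers n≥) (begin
    9216 * K * n
      ≡⟨ cong (9216 * K *_) n≡ ⟩
    9216 * K * (2 + (m + m))
      ≡⟨ regroup K (m + m) ⟩
    9216 * ((m + m) * K) + 18432 * K
      ≤⟨ +-monoˡ-≤ (18432 * K) (*-monoʳ-≤ 9216 main) ⟩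
    9216 * (ω * n + ω′ + (2 * h + (x * 50 + e) + 8 * s) * K) + 18432 * K
      ≡⟨ regroup₂ K (ω * n) ω′ h x e s ⟩
    -- The factors 1024, 225, 72 and 288 are 9216 times 2 / 18, 50 / 2048, 1 / 128 and 8 / 256. They
    -- give the slope 1753 = 1024 + 225 + 3 · 72 + 288 and the constant 27648 = 9 · 1024 + 2 · 9216.
    9216 * (ω * n) + 9216 * ω′ + (1024 * (18 * h) + 225 * (2048 * x) + 72 * (128 * e) + 288 * (256 * s)) * K + 18432 * K
      ≤⟨ +-monoˡ-≤ (18432 * K) (+-monoʳ-≤ (9216 * (ω * n) + 9216 * ω′) (*-monoˡ-≤ K
           (+-mono-≤ (+-mono-≤ (+-mono-≤ (*-monoʳ-≤ 1024 h≤) (*-monoʳ-≤ 225 x≤)) (*-monoʳ-≤ 72 e≤)) (*-monoʳ-≤ 288 s≤)))) ⟩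
    9216 * (ω * n) + 9216 * ω′ + (1024 * (n + 9) + 225 * n + 72 * (3 * n) + 288 * n) * K + 18432 * K
      ≡⟨ regroup₃ K n ω ω′ ⟩
    (1753 * K + 9216 * ω) * n + (27648 * K + 9216 * ω′) ∎)
  where
  open ≤-Reasoning
  regroup : ∀ K y → 9216 * K * (2 + y) ≡ 9216 * (y * K) + 18432 * K
  regroup = solve-∀
  regroup₂ : ∀ K c ω′ h x e s → 9216 * (c + ω′ + (2 * h + (x * 50 + e) + 8 * s) * K) + 18432 * K
    ≡ 9216 * c + 9216 * ω′ + (1024 * (18 * h) + 225 * (2048 * x) + 72 * (128 * e) + 288 * (256 * s)) * K + 18432 * K
  regroup₂ = solve-∀
  regroup₃ : ∀ K n ω ω′ → 9216 * (ω * n) + 9216 * ω′ + (1024 * (n + 9) + 225 * n + 72 * (3 * n) + 288 * n) * K + 18432 * K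
    ≡ (1753 * K + 9216 * ω) * n + (27648 * K + 9216 * ω′)
  regroup₃ = solve-∀

odd-form : ∀ q → 2 ∤ q → ∃ λ i → q ≡ suc (2 * i)
odd-form q 2∤q with half q
... | double i = contradiction (divides i (trans (cong (i +_) (sym (+-identityʳ i))) (*-comm 2 i))) 2∤q
... | double+1 i = i , trans (+-suc i i) (cong (λ k → suc (i + k)) (sym (+-identityʳ i)))

-- Large n

2∤n∸p : ∀ {n p} → 2 ∣ n → p ≤ n → 2 ∤ p → 2 ∤ n ∸ p
2∤n∸p {n} {p} 2∣n p≤n 2∤p 2∣ = 2∤p (∣m+n∣m⇒∣n (subst (2 ∣_) (sym (m∸n+n≡m p≤n)) 2∣n) 2∣)

OddPrimesCovered : List (ℕ × ℕ × ℕ) → Set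
OddPrimesCovered tab = ∀ q → Prime q → 2 ∤ q → q < 512 → Any (λ e → proj₁ e ≡ q) tab

module Large (u v : ℕ) (tab : List (ℕ × ℕ × ℕ)) (covered : OddPrimesCovered tab) (m : ℕ) (n : ℕ) (n≡ : n ≡ 2 + (m + m)) (n≥ : 65536 ≤ n)
  (allBad : ∀ p → Prime p → 2 ∤ p → p < n → ∃ λ q → Prime q × q * q ∣ n ∸ p) where

  K h x N : ℕ
  K = u * v
  h = (n + 9) / 18
  x = n / 2048
  N = suc (m + m)

  n+9< : n + 9 < 18 * suc h
  n+9< = subst (n + 9 <_) (*-comm (suc h) 18) (m<[1+m/n]*n (n + 9) 18)

  open Covering n h n+9<

  2∣n : 2 ∣ n
  2∣n = subst (2 ∣_) (sym n≡) (divides (suc m) (regroup m))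
    where
    regroup : ∀ m → 2 + (m + m) ≡ suc m * 2
    regroup = solve-∀

  2≤h : 2 ≤ h
  2≤h with 2 ≤? h
  ... | yes 2≤h = 2≤h
  ... | no 2≰h = contradiction (≤-trans n≥ (m≤m+n n 9)) (<⇒≱ (<-≤-trans n+9< (≤-trans (*-monoʳ-≤ 18 (≰⇒> 2≰h)) (≤ᵇ⇒≤ 36 65536 _))))

  p<n : ∀ {p} → p ≤ N → p < n
  p<n p≤N = subst (_ <_) (sym n≡) (s≤s p≤N)

  CoveringNumber : ℕ → Set
  CoveringNumber s = ∃₂ λ Z e → 0 < Z × Z ^ K ≤ 2 ^ (weight tab * n + offset tab) * (2 ^ (x * 50 + e)) ^ K ×
    128 * e ≤ 3 * n × (∀ q → q ≤ s → Covers q Z)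

  covering-number : ∀ s → s * s ≤ n → All (Entry u v) tab → CoveringNumber s
  covering-number s s²≤n entries = build (table-cover u v tab entries) (dyadic-size 8 s)
    where
    -- The blocks start at J = 8, since q = 2i + 1 > 512 means i ≥ 2^8. Hence 2048 = 2^(3 + J), and
    -- the factor of x is 18 + 4J = 50.
    n<′ : n < suc x * 2 ^ 11
    n<′ = subst (λ d → n < suc x * d) 2048≡2^11 (m<[1+m/n]*n n 2048)
      where
      2048≡2^11 : 2048 ≡ 2 ^ 11
      2048≡2^11 = refl
    build : (∃ λ Z → 0 < Z × Z ^ (u * v) ≤ 2 ^ (weight tab * n + offset tab) ×
              (∀ {q} → Any (λ e → proj₁ e ≡ q) tab → Covers q Z)) →
            (∃ λ len → s < 2 ^ suc (8 + len) × (len ≡ 0 ⊎ 2 ^ (8 + len) ≤ s)) → CoveringNumber s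
    build (Z₁ , Z₁>0 , Z₁≤ , cov₁) (len , s< , small) = merge (tail-cover len 8 x (s≤s z≤n) n<′)
      where
      e≤ : len ≡ 0 ⊎ 2 ^ (8 + len) ≤ s → 128 * excess 8 len ≤ 3 * n
      e≤ (inj₁ refl) = z≤n
      e≤ (inj₂ w≤s) = ≤-trans (excess≤ len) (*-monoʳ-≤ 3 (≤-trans (*-mono-≤ w≤s w≤s) s²≤n))
      merge : (∃ λ Z → 0 < Z × Z ≤ 2 ^ (x * 50 + excess 8 len) ×
                (∀ i → 2 ^ 8 ≤ i → i < 2 ^ (8 + len) → Covers (suc (2 * i)) Z)) → CoveringNumber s
      merge (Z₂ , Z₂>0 , Z₂≤ , cov₂) =
        Z₁ * Z₂ , excess 8 len , *-mono-≤ Z₁>0 Z₂>0 ,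
        subst (_≤ 2 ^ (weight tab * n + offset tab) * (2 ^ (x * 50 + excess 8 len)) ^ K) (sym (^-distribʳ-* Z₁ Z₂ K))
          (*-mono-≤ Z₁≤ (^-monoˡ-≤ K Z₂≤)) ,
        e≤ small , cov
        where
        cov-large : ∀ q → 512 ≤ q → q ≤ s → (∃ λ i → q ≡ suc (2 * i)) → Covers q (Z₁ * Z₂)
        cov-large q 512≤q q≤s (i , refl) = covers-∣ (n∣m*n Z₁) (cov₂ i i≥ i<)
          where
          i≥ : 256 ≤ i
          i≥ = ≮⇒≥ λ i<256 → ≤⇒≯ 512≤q (≤-trans (≤-reflexive (sym (*-suc 2 i))) (*-monoʳ-≤ 2 i<256))
          i< : i < 2 ^ (8 + len)
          i< = *-cancelˡ-< 2 i (2 ^ (8 + len)) (≤-<-trans (≤-trans (n≤1+n (2 * i)) q≤s) s<)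
        cov : ∀ q → q ≤ s → Covers q (Z₁ * Z₂)
        cov q q≤s pq 2∤q =
          [ (λ q<512 → covers-∣ (m∣m*n Z₂) (cov₁ (covered q pq 2∤q q<512)) pq 2∤q)
          , (λ 512≤q → cov-large q 512≤q q≤s (odd-form q 2∤q) pq 2∤q)
          ]′ (<-≤-connex q 512)

  -- Primes up to h divide X. A larger p is odd because h ≥ 2, so n - p is odd; then q and the
  -- cofactor (n - p) / q² are odd too, as `Covers` requires, and q² ≤ n - 1 gives q ≤ s.
  prime∣W : ∀ {s X} → N < suc s * suc s → (∀ p → Prime p → p ≤ h → p ∣ X) → ∀ Z → (∀ q → q ≤ s → Covers q Z) →
    ∀ p → Prime p → p ≤ N → p ∣ X * Z
  prime∣W {s} {X} N< primes Z covers p pp p≤N with p ≤? h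
  ... | yes p≤h = ∣m⇒∣m*n Z (primes p pp p≤h)
  ... | no p≰h = ∣n⇒∣m*n X (from (allBad p pp 2∤p (p<n p≤N)))
    where
    2∤p : 2 ∤ p
    2∤p 2∣p with prime⇒irreducible pp 2∣p
    ... | inj₂ refl = p≰h 2≤h
    n∸p≡ : ∀ {d} → d ≡ n ∸ p → n ≡ p + d
    n∸p≡ refl = sym (m+[n∸m]≡n (<⇒≤ (p<n p≤N)))
    2∤d : 2 ∤ n ∸ p
    2∤d = 2∤n∸p 2∣n (<⇒≤ (p<n p≤N)) 2∤p
    from : (∃ λ q → Prime q × q * q ∣ n ∸ p) → p ∣ Z
    from (q , pq , divides w eq) with odd-form w (λ 2∣w → 2∤d (subst (2 ∣_) (sym eq) (∣m⇒∣m*n (q * q) 2∣w)))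
    ... | t , refl = covers q (square-cancel-< (≤-<-trans q²≤N N<)) pq 2∤q p t pp (≰⇒> p≰h)
                       (n∸p≡ (trans (*-comm (q * q) (suc (2 * t))) (sym eq)))
      where
      2∤q : 2 ∤ q
      2∤q 2∣q = 2∤d (subst (2 ∣_) (sym eq) (∣n⇒∣m*n (suc (2 * t)) (∣m⇒∣m*n q 2∣q)))
      q²≤N : q * q ≤ N
      q²≤N = ≤-trans (≤-trans (m≤m+n (q * q) _) (≤-reflexive (sym eq)))
               (≤-trans (∸-monoʳ-≤ n (prime>0 pp)) (≤-reflexive (cong (_∸ 1) n≡)))

  impossible : All (Entry u v) tab →
    ¬ ((1753 * K + 9216 * weight tab) * 65536 + (27648 * K + 9216 * offset tab) < 9216 * K * 65536)
  impossible entries = go (isqrt N)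
    where
    open ≤-Reasoning
    go : (∃ λ s → s * s ≤ N × N < suc s * suc s) →
      ¬ ((1753 * K + 9216 * weight tab) * 65536 + (27648 * K + 9216 * offset tab) < 9216 * K * 65536)
    go (s , s²≤N , N<) = conclude (covering-number s s²≤n entries) (primorial-bound h) (commonMultiple-bound s)
      where
      s²≤n : s * s ≤ n
      s²≤n = ≤-trans s²≤N (<⇒≤ (p<n ≤-refl))
      256s≤n : 256 * s ≤ n
      -- 65536 = 256² serves the first case, s² ≤ n the second.
      256s≤n with s ≤? 256
      ... | yes s≤256 = ≤-trans (*-monoʳ-≤ 256 s≤256) n≥
      ... | no s≰256 = ≤-trans (*-monoˡ-≤ s (<⇒≤ (≰⇒> s≰256))) s²≤n
      conclude : CoveringNumber s → PrimorialBound h → CommonMultipleBound s →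
        ¬ ((1753 * K + 9216 * weight tab) * 65536 + (27648 * K + 9216 * offset tab) < 9216 * K * 65536)
      conclude (Z , e , Z>0 , Z≤ , e≤ , covers) (X , X>0 , X≤ , primes) (Y , Y>0 , Y≤ , cm) =
        exponents-contradict {K} {n} {m} {h} {x} {e} {s} {weight tab} {offset tab} n≡ n≥
          (subst (_≤ n + 9) (*-comm h 18) (m/n*n≤m (n + 9) 18))
          (subst (_≤ n) (*-comm x 2048) (m/n*n≤m n 2048)) e≤ 256s≤n exponents
        where
        a b : ℕ
        a = weight tab * n + offset tab
        b = x * 50 + e
        4^m≤ : 4 ^ m ≤ X * Z * (Y * Y)
        4^m≤ = 4^m≤commonMultiple {m} (*-mono-≤ (*-mono-≤ X>0 Z>0) (*-mono-≤ Y>0 Y>0))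
                 (primes+roots⇒commonMultiple N< (prime∣W N< primes Z covers) cm)
        regroup : ∀ X Z Y → X * Z * (Y * Y) ≡ Z * (X * (Y * Y))
        regroup = solve-∀
        regroup₂ : ∀ A B D → A * B * D ≡ A * (D * B)
        regroup₂ = solve-∀
        regroup₃ : ∀ h b s → 2 * h + (4 * s + 4 * s) + b ≡ 2 * h + b + 8 * s
        regroup₃ = solve-∀
        XY²≤ : X * (Y * Y) ≤ 2 ^ (2 * h + (4 * s + 4 * s))
        XY²≤ = begin
          X * (Y * Y)                                   ≤⟨ *-mono-≤ X≤ (*-mono-≤ Y≤ Y≤) ⟩
          4 ^ h * (16 ^ s * 16 ^ s)                     ≡⟨ cong₂ (λ y z → y * (z * z)) (^-*-assoc 2 2 h) (^-*-assoc 2 4 s) ⟩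
          2 ^ (2 * h) * (2 ^ (4 * s) * 2 ^ (4 * s))     ≡⟨ cong (2 ^ (2 * h) *_) (sym (^-distribˡ-+-* 2 (4 * s) (4 * s))) ⟩
          2 ^ (2 * h) * 2 ^ (4 * s + 4 * s)             ≡⟨ sym (^-distribˡ-+-* 2 (2 * h) (4 * s + 4 * s)) ⟩
          2 ^ (2 * h + (4 * s + 4 * s))                 ∎
        exponents : (m + m) * K ≤ a + (2 * h + b + 8 * s) * K
        exponents = ^-cancelʳ-≤ (begin
          2 ^ ((m + m) * K)                 ≡⟨ sym (^-*-assoc 2 (m + m) K) ⟩
          (2 ^ (m + m)) ^ K                 ≡⟨ cong (λ k → (2 ^ (m + k)) ^ K) (sym (+-identityʳ m)) ⟩
          (2 ^ (2 * m)) ^ K                 ≡⟨ cong (_^ K) (sym (^-*-assoc 2 2 m)) ⟩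
          (4 ^ m) ^ K                       ≤⟨ ^-monoˡ-≤ K 4^m≤ ⟩
          (X * Z * (Y * Y)) ^ K             ≡⟨ cong (_^ K) (regroup X Z Y) ⟩
          (Z * (X * (Y * Y))) ^ K           ≡⟨ ^-distribʳ-* Z (X * (Y * Y)) K ⟩
          Z ^ K * (X * (Y * Y)) ^ K         ≤⟨ *-mono-≤ Z≤ (^-monoˡ-≤ K XY²≤) ⟩
          2 ^ a * (2 ^ b) ^ K * (2 ^ (2 * h + (4 * s + 4 * s))) ^ K
            ≡⟨ regroup₂ (2 ^ a) ((2 ^ b) ^ K) ((2 ^ (2 * h + (4 * s + 4 * s))) ^ K) ⟩
          2 ^ a * ((2 ^ (2 * h + (4 * s + 4 * s))) ^ K * (2 ^ b) ^ K)
            ≡⟨ cong (2 ^ a *_) (sym (^-distribʳ-* (2 ^ (2 * h + (4 * s + 4 * s))) (2 ^ b) K)) ⟩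
          2 ^ a * (2 ^ (2 * h + (4 * s + 4 * s)) * 2 ^ b) ^ K
            ≡⟨ cong (λ y → 2 ^ a * y ^ K) (sym (^-distribˡ-+-* 2 (2 * h + (4 * s + 4 * s)) b)) ⟩
          2 ^ a * (2 ^ (2 * h + (4 * s + 4 * s) + b)) ^ K
            ≡⟨ cong (λ y → 2 ^ a * (2 ^ y) ^ K) (regroup₃ h b s) ⟩
          2 ^ a * (2 ^ (2 * h + b + 8 * s)) ^ K
            ≡⟨ cong (2 ^ a *_) (^-*-assoc 2 (2 * h + b + 8 * s) K) ⟩
          2 ^ a * 2 ^ ((2 * h + b + 8 * s) * K)
            ≡⟨ sym (^-distribˡ-+-* 2 a ((2 * h + b + 8 * s) * K)) ⟩
          2 ^ (a + (2 * h + b + 8 * s) * K) ∎)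

-- The entries are (q , t , ⌈512 t / q²⌉) with t = ⌈64 log₂ 8q²⌉, for the odd primes q < 512.
table : List (ℕ × ℕ × ℕ)
table =
  (3 , 395 , 22472) ∷ (5 , 490 , 10036) ∷ (7 , 552 , 5768) ∷ (11 , 635 , 2687) ∷ (13 , 666 , 2018) ∷ (17 , 716 , 1269) ∷
  (19 , 736 , 1044) ∷ (23 , 772 , 748) ∷ (29 , 814 , 496) ∷ (31 , 827 , 441) ∷ (37 , 859 , 322) ∷ (41 , 878 , 268) ∷
  (43 , 887 , 246) ∷ (47 , 903 , 210) ∷ (53 , 926 , 169) ∷ (59 , 945 , 139) ∷ (61 , 952 , 131) ∷ (67 , 969 , 111) ∷
  (71 , 980 , 100) ∷ (73 , 985 , 95) ∷ (79 , 999 , 82) ∷ (83 , 1009 , 75) ∷ (89 , 1021 , 66) ∷ (97 , 1037 , 57) ∷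
  (101 , 1045 , 53) ∷ (103 , 1048 , 51) ∷ (107 , 1055 , 48) ∷ (109 , 1059 , 46) ∷ (113 , 1065 , 43) ∷ (127 , 1087 , 35) ∷
  (131 , 1093 , 33) ∷ (137 , 1101 , 31) ∷ (139 , 1104 , 30) ∷ (149 , 1117 , 26) ∷ (151 , 1119 , 26) ∷ (157 , 1126 , 24) ∷
  (163 , 1133 , 22) ∷ (167 , 1138 , 21) ∷ (173 , 1144 , 20) ∷ (179 , 1150 , 19) ∷ (181 , 1152 , 19) ∷ (191 , 1162 , 17) ∷
  (193 , 1164 , 16) ∷ (197 , 1168 , 16) ∷ (199 , 1170 , 16) ∷ (211 , 1181 , 14) ∷ (223 , 1191 , 13) ∷ (227 , 1194 , 12) ∷
  (229 , 1196 , 12) ∷ (233 , 1199 , 12) ∷ (239 , 1204 , 11) ∷ (241 , 1205 , 11) ∷ (251 , 1213 , 10) ∷ (257 , 1217 , 10) ∷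
  (263 , 1221 , 10) ∷ (269 , 1226 , 9) ∷ (271 , 1227 , 9) ∷ (277 , 1231 , 9) ∷ (281 , 1234 , 9) ∷ (283 , 1235 , 8) ∷
  (293 , 1241 , 8) ∷ (307 , 1250 , 7) ∷ (311 , 1252 , 7) ∷ (313 , 1254 , 7) ∷ (317 , 1256 , 7) ∷ (331 , 1264 , 6) ∷
  (337 , 1267 , 6) ∷ (347 , 1273 , 6) ∷ (349 , 1274 , 6) ∷ (353 , 1276 , 6) ∷ (359 , 1279 , 6) ∷ (367 , 1283 , 5) ∷
  (373 , 1286 , 5) ∷ (379 , 1289 , 5) ∷ (383 , 1291 , 5) ∷ (389 , 1294 , 5) ∷ (397 , 1298 , 5) ∷ (401 , 1299 , 5) ∷
  (409 , 1303 , 4) ∷ (419 , 1307 , 4) ∷ (421 , 1308 , 4) ∷ (431 , 1313 , 4) ∷ (433 , 1314 , 4) ∷ (439 , 1316 , 4) ∷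
  (443 , 1318 , 4) ∷ (449 , 1320 , 4) ∷ (457 , 1324 , 4) ∷ (461 , 1325 , 4) ∷ (463 , 1326 , 4) ∷ (467 , 1328 , 4) ∷
  (479 , 1332 , 3) ∷ (487 , 1335 , 3) ∷ (491 , 1337 , 3) ∷ (499 , 1340 , 3) ∷ (503 , 1341 , 3) ∷ (509 , 1343 , 3) ∷ []

entries : All (Entry 64 1024) table
entries = toWitness {a? = all? (λ (q , t , c) → 3 ≤? q ×-dec (8 * (q * q)) ^ 64 ≤? 2 ^ t ×-dec 1024 * t ≤? c * (2 * (q * q))) table} _

-- The table contributes about 0.763 to the slope and 1753 / 9216 is about 0.190; the gap to 1 must
-- absorb the offset at n = 65536.
weights-suffice : (1753 * (64 * 1024) + 9216 * weight table) * 65536 + (27648 * (64 * 1024) + 9216 * offset table) < 9216 * (64 * 1024) * 65536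
weights-suffice = <ᵇ⇒<
  ((1753 * (64 * 1024) + 9216 * weight table) * 65536 + (27648 * (64 * 1024) + 9216 * offset table))
  (9216 * (64 * 1024) * 65536) _

-- Only the middle alternative survives for an odd prime. Completeness of a list of primes below a
-- bound thus becomes a finite check by trial division: divisors up to 19 suffice below 512 < 23²,
-- and up to 13 below 256 < 17².
odd-prime : ∀ {q} {A : Set} {ds} → Prime q → 2 ∤ q → q < 3 ⊎ A ⊎ Any (λ d → 1 < d × d < q × d ∣ q) ds → A
odd-prime {0} pq _ (inj₁ _) = contradiction pq ¬prime[0]
odd-prime {1} pq _ (inj₁ _) = contradiction pq ¬prime[1]
odd-prime {2} _ 2∤q (inj₁ _) = contradiction ∣-refl 2∤q
odd-prime {suc (suc (suc _))} _ _ (inj₁ (s≤s (s≤s (s≤s ()))))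
odd-prime _ _ (inj₂ (inj₁ a)) = a
odd-prime pq _ (inj₂ (inj₂ div)) with Any.satisfied div
... | d , 1<d , d<q , d∣q with prime⇒irreducible pq d∣q
...   | inj₁ refl = contradiction 1<d λ { (s≤s ()) }
...   | inj₂ refl = contradiction d<q (<-irrefl refl)

covered : OddPrimesCovered table
covered q pq 2∤q q<512 = odd-prime pq 2∤q (classify q<512)
  where
  classify : ∀ {q} → q < 512 → q < 3 ⊎ Any (λ e → proj₁ e ≡ q) table ⊎
    Any (λ d → 1 < d × d < q × d ∣ q) (2 ∷ 3 ∷ 5 ∷ 7 ∷ 11 ∷ 13 ∷ 17 ∷ 19 ∷ [])
  classify = toWitness {a? = allUpTo? (λ q → q <? 3 ⊎-dec any? (λ e → proj₁ e ≟ q) table ⊎-dec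
    any? (λ d → 1 <? d ×-dec d <? q ×-dec d ∣? q) _) 512} _

primes<256 : List ℕ
primes<256 =
  3 ∷ 5 ∷ 7 ∷ 11 ∷ 13 ∷ 17 ∷ 19 ∷ 23 ∷ 29 ∷ 31 ∷ 37 ∷ 41 ∷ 43 ∷ 47 ∷
  53 ∷ 59 ∷ 61 ∷ 67 ∷ 71 ∷ 73 ∷ 79 ∷ 83 ∷ 89 ∷ 97 ∷ 101 ∷ 103 ∷ 107 ∷ 109 ∷
  113 ∷ 127 ∷ 131 ∷ 137 ∷ 139 ∷ 149 ∷ 151 ∷ 157 ∷ 163 ∷ 167 ∷ 173 ∷ 179 ∷ 181 ∷ 191 ∷
  193 ∷ 197 ∷ 199 ∷ 211 ∷ 223 ∷ 227 ∷ 229 ∷ 233 ∷ 239 ∷ 241 ∷ 251 ∷ []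

primes<256-complete : ∀ q → Prime q → 2 ∤ q → q < 256 → Any (_≡ q) primes<256
primes<256-complete q pq 2∤q q<256 = odd-prime pq 2∤q (classify q<256)
  where
  classify : ∀ {q} → q < 256 → q < 3 ⊎ Any (_≡ q) primes<256 ⊎
    Any (λ d → 1 < d × d < q × d ∣ q) (2 ∷ 3 ∷ 5 ∷ 7 ∷ 11 ∷ 13 ∷ [])
  classify = toWitness {a? = allUpTo? (λ q → q <? 3 ⊎-dec any? (_≟ q) primes<256 ⊎-dec
    any? (λ d → 1 <? d ×-dec d <? q ×-dec d ∣? q) _) 256} _

-- Small n

Representable : ℕ → Set
Representable n = ∃ λ p → p < n × Prime p × 2 ∤ p × (∀ q → Prime q → q * q ∤ n ∸ p)

-- The value at q = 0 is a default, as `%` takes a nonzero divisor; `noSquare-sound` assumes 0 < q.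
noSquare : ℕ → ℕ → Bool
noSquare m zero = true
noSquare m q@(suc _) = not (m % (q * q) ≡ᵇ 0)

noSquare-sound : ∀ m {q} → 0 < q → T (noSquare m q) → q * q ∤ m
noSquare-sound m {q@(suc _)} _ ok q²∣m with m % (q * q) | n∣m⇒m%n≡0 m (q * q) q²∣m
... | .0 | refl = ok

candidates : List ℕ
candidates = 3 ∷ 5 ∷ 7 ∷ 11 ∷ 13 ∷ 17 ∷ 19 ∷ 23 ∷ 29 ∷ []

candidates-odd-prime : All (λ p → Prime p × 2 ∤ p) candidates
candidates-odd-prime = toWitness {a? = all? (λ p → prime? p ×-dec ¬? (2 ∣? p)) candidates} _

represented : ℕ → Bool
represented n = any (λ p → (p <ᵇ n) ∧ all (noSquare (n ∸ p)) primes<256) candidates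

represented-sound : ∀ {n} → 2 ∣ n → n < 65536 → T (represented n) → Representable n
represented-sound {n} 2∣n n< ok = extract (any⁻ (λ p → (p <ᵇ n) ∧ all (noSquare (n ∸ p)) primes<256) candidates ok)
  where
  extract : Any (λ p → T ((p <ᵇ n) ∧ all (noSquare (n ∸ p)) primes<256)) candidates → Representable n
  extract i = p , p<n , proj₁ (proj₁ found) , 2∤p , square-free
    where
    p : ℕ
    p = Any.lookup i
    found : (Prime p × 2 ∤ p) × T ((p <ᵇ n) ∧ all (noSquare (n ∸ p)) primes<256)
    found = All.lookupAny candidates-odd-prime i
    checks : T (p <ᵇ n) × T (all (noSquare (n ∸ p)) primes<256)
    checks = Equivalence.to (T-∧ {p <ᵇ n}) (proj₂ found)
    p<n : p < n
    p<n = <ᵇ⇒< p n (proj₁ checks)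
    2∤p : 2 ∤ p
    2∤p = proj₂ (proj₁ found)
    square-free : ∀ q → Prime q → q * q ∤ n ∸ p
    square-free q pq q²∣ = excluded (All.lookupAny (all⁺ (noSquare (n ∸ p)) primes<256 (proj₂ checks)) (primes<256-complete q pq 2∤q q<256)) q²∣
      where
      2∤q : 2 ∤ q
      2∤q 2∣q = 2∤n∸p 2∣n (<⇒≤ p<n) 2∤p (∣-trans (∣m⇒∣m*n q 2∣q) q²∣)
      q<256 : q < 256
      q<256 = s≤s (square-cancel-< (≤-<-trans (≤-trans (∣⇒≤ {{>-nonZero (m<n⇒0<n∸m p<n)}} q²∣) (m∸n≤m n p)) n<))
      excluded : ∀ {q′} → T (noSquare (n ∸ p) q′) × q′ ≡ q → q * q ∤ n ∸ p
      excluded (ok′ , refl) = noSquare-sound (n ∸ p) (prime>0 pq) ok′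

allRepresented : ℕ → Bool
allRepresented zero = true
allRepresented (suc k) = represented (4 + (k + k)) ∧ allRepresented k

allRepresented-sound : ∀ K → T (allRepresented K) → ∀ {k} → k < K → T (represented (4 + (k + k)))
allRepresented-sound (suc K) ok k<
  with Equivalence.to (T-∧ {represented (4 + (K + K))}) ok | m≤n⇒m<n∨m≡n (≤-pred k<)
... | now , later | inj₁ k<K = allRepresented-sound K later k<K
... | now , later | inj₂ refl = now

-- 32766 = (65536 - 4) / 2, so n = 4 + 2k runs over the even numbers from 4 to 65534.
verified : ∀ {k} → k < 32766 → T (represented (4 + (k + k)))
verified = allRepresented-sound 32766 _

-- Conclusion from the two ranges

primeSquareDivisor? : ∀ m → Dec (∃ λ q → q < suc m × Prime q × q * q ∣ m)
primeSquareDivisor? m = anyUpTo? (λ q → prime? q ×-dec q * q ∣? m) (suc m)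

good? : ∀ n p → Dec (Prime p × 2 ∤ p × ¬ ∃ λ q → q < suc (n ∸ p) × Prime q × q * q ∣ n ∸ p)
good? n p = prime? p ×-dec ¬? (2 ∣? p) ×-dec ¬? (primeSquareDivisor? (n ∸ p))

-- The searches for p and for q are bounded, hence decidable. Failure of the search for p therefore
-- yields constructively, for each odd prime p < n, a prime q with q² ∣ n - p.
large-representable : ∀ m n → n ≡ 2 + (m + m) → 65536 ≤ n → Representable n
large-representable m n n≡ n≥ = decide (anyUpTo? (good? n) n)
  where
  Good : ℕ → Set
  Good p = Prime p × 2 ∤ p × ¬ ∃ λ q → q < suc (n ∸ p) × Prime q × q * q ∣ n ∸ p
  decide : Dec (∃ λ p → p < n × Good p) → Representable n
  decide (yes (p , p<n , pp , 2∤p , none)) = p , p<n , pp , 2∤p ,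
    λ q pq q²∣ → none (q , s≤s (≤-trans (m≤m*n q q {{prime⇒nonZero pq}}) (∣⇒≤ {{>-nonZero (m<n⇒0<n∸m p<n)}} q²∣)) , pq , q²∣)
  decide (no ¬good) = contradiction weights-suffice (Large.impossible 64 1024 table covered m n n≡ n≥ allBad entries)
    where
    allBad : ∀ p → Prime p → 2 ∤ p → p < n → ∃ λ q → Prime q × q * q ∣ n ∸ p
    allBad p pp 2∤p p<n = forget (decidable-stable (primeSquareDivisor? (n ∸ p)) λ none → ¬good (p , p<n , pp , 2∤p , none))
      where
      forget : (∃ λ q → q < suc (n ∸ p) × Prime q × q * q ∣ n ∸ p) → ∃ λ q → Prime q × q * q ∣ n ∸ p
      forget (q , _ , pq , q²∣) = q , pq , q²∣

even-representable : ∀ k → Representable (4 + (k + k))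
even-representable k = [ small , large-representable (suc k) (4 + (k + k)) (cong (3 +_) (sym (+-suc k k))) ]′ (<-≤-connex (4 + (k + k)) 65536)
  where
  2∣ : 2 ∣ 4 + (k + k)
  2∣ = divides (2 + k) (regroup k)
    where
    regroup : ∀ k → 4 + (k + k) ≡ (2 + k) * 2
    regroup = solve-∀
  small : 4 + (k + k) < 65536 → Representable (4 + (k + k))
  small n< = represented-sound 2∣ n< (verified {k} (≰⇒> λ 32766≤k → <⇒≱ n< (+-monoʳ-≤ 4 (+-mono-≤ 32766≤k 32766≤k))))

theorem3 : ∀ (n : ℕ) → n > 3 → 2 ∣ n →
    ∃₂ λ (p η : ℕ) → Prime p × 2 ∤ η × SquareFree η × n ≡ p + η
theorem3 n n>3 2∣n@(divides r n≡r*2) = conclude (subst Representable (sym n≡) (even-representable (r ∸ 2)))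
  where
  regroup : ∀ k → (2 + k) * 2 ≡ 4 + (k + k)
  regroup = solve-∀
  2≤r : 2 ≤ r
  2≤r = *-cancelʳ-≤ 2 r 2 (subst (4 ≤_) n≡r*2 n>3)
  n≡ : n ≡ 4 + ((r ∸ 2) + (r ∸ 2))
  n≡ = trans n≡r*2 (trans (cong (_* 2) (sym (m+[n∸m]≡n 2≤r))) (regroup (r ∸ 2)))
  conclude : Representable n → ∃₂ λ (p η : ℕ) → Prime p × 2 ∤ η × SquareFree η × n ≡ p + η
  conclude (p , p<n , pp , 2∤p , square-free) =
    p , n ∸ p , pp , 2∤n∸p 2∣n (<⇒≤ p<n) 2∤p , (m<n⇒0<n∸m p<n , square-free) , sym (m+[n∸m]≡n (<⇒≤ p<n))
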